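{- There exist absolute constants $c_*>0$ and $K>0$ such that for every finite abelian group $\mathbf{G}$ of order $N$, the number $T(\mathbf{G})$ of ordered triples $(A,B,C)$ of subsets of $\mathbf{G}$ such that $x+y\neq z$ for all $x\in A$, $y\in B$, $z\in C$ satisfies $$|T(\mathbf{G})-3\cdot 4^N|\leqslant K(4-c_*)^N .$$
   Context: The subsets $A,B,C$ may be empty. -}

module Defs where

open import Algebra.Bundles using (AbelianGroup)
open import Algebra.Definitions.RawSemiring using (_^_)
open import Data.Bool.Base using (true; false)
open import Data.Fin.Base using (Fin)
import Data.Fin.Properties as Fin
open import Data.Fin.Subset using (Subset; _∈_)
open import Data.Fin.Subset.Properties using (_∈?_)
open import Data.List.Base using (List; []; _∷_; length; filter; cartesianProduct; cartesianProductWith)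
open import Data.Nat.Base using (ℕ; zero; suc)
open import Data.Product.Base using (_×_; _,_; proj₁; proj₂)
open import Data.Rational.Base using (ℚ; +-*-rawSemiring)
import Data.Vec.Base as Vec
open import Function.Bundles using (Inverse)
open import Level using (Level; _⊔_)
open import Relation.Binary.Definitions using (Decidable)
import Relation.Binary.PropositionalEquality as ≡
open import Relation.Nullary using (¬_; Dec)
open import Relation.Nullary.Decidable using (map′; ¬?; _→-dec_)

private
  variable
    a ℓ : Level

-- Real constants c, K > 0 in a bound x ≤ K (4 - c)^N are taken rational: if
-- 0 ≤ 4 - c, shrinking c and enlarging K to rationals only weakens the bound,
-- and c ≤ 4 is forced by the case N = 1.
infixr 8 _^ℚ_
_^ℚ_ : ℚ → ℕ → ℚ
_^ℚ_ = _^_ +-*-rawSemiring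

-- Elements are counted up to the group's setoid equality.
HasOrder : AbelianGroup a ℓ → ℕ → Set (a ⊔ ℓ)
HasOrder G N = Inverse (AbelianGroup.setoid G) (≡.setoid (Fin N))

subsets : ∀ n → List (Subset n)
subsets zero    = Vec.[] ∷ []
subsets (suc n) = cartesianProductWith Vec._∷_ (true ∷ false ∷ []) (subsets n)

module _ (G : AbelianGroup a ℓ) {N : ℕ} (enum : HasOrder G N) where
  open AbelianGroup G hiding (inverse)
  open Inverse enum using (to; from; to-cong; inverse)

  -- A subset of the group is a Subset N of positions in the enumeration;
  -- this is membership of a group element in it.
  Member : Carrier → Subset N → Set
  Member x A = to x ∈ A

  SumFree : Subset N × Subset N × Subset N → Set (a ⊔ ℓ)
  SumFree (A , B , C) =
    ∀ x y z → Member x A → Member y B → Member z C → ¬ (x ∙ y ≈ z)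

  private
    from-to : ∀ x → from (to x) ≈ x
    from-to x = proj₂ inverse ≡.refl

    to-from : ∀ i → to (from i) ≡.≡ i
    to-from i = proj₁ inverse refl

    _≈?_ : Decidable _≈_
    x ≈? y = map′
      (λ eq → trans (sym (from-to x)) (proj₂ inverse eq))
      to-cong (to x Fin.≟ to y)

  sumFree? : ∀ t → Dec (SumFree t)
  sumFree? (A , B , C) = map′ fromIndices toIndices
    (Fin.all? λ i → Fin.all? λ j → Fin.all? λ k →
      (i ∈? A) →-dec ((j ∈? B) →-dec ((k ∈? C) →-dec
        ¬? ((from i ∙ from j) ≈? from k))))
    where
    OnIndices : Set ℓ
    OnIndices = ∀ i j k → i ∈ A → j ∈ B → k ∈ C → ¬ (from i ∙ from j ≈ from k)

    fromIndices : OnIndices → SumFree (A , B , C)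
    fromIndices h x y z x∈A y∈B z∈C x∙y≈z =
      h (to x) (to y) (to z) x∈A y∈B z∈C
        (trans (∙-cong (from-to x) (from-to y)) (trans x∙y≈z (sym (from-to z))))

    toIndices : SumFree (A , B , C) → OnIndices
    toIndices h i j k i∈A j∈B k∈C =
      h (from i) (from j) (from k)
        (≡.subst (_∈ A) (≡.sym (to-from i)) i∈A)
        (≡.subst (_∈ B) (≡.sym (to-from j)) j∈B)
        (≡.subst (_∈ C) (≡.sym (to-from k)) k∈C)

  T : ℕ
  T = length (filter sumFree?
        (cartesianProduct (subsets N) (cartesianProduct (subsets N) (subsets N))))

{-# OPTIONS --safe #-}
module Submission where

-- Solving x + y = z for one of its terms gives a Latin square ∘ on the group, and
-- the triple has no solution iff v ∘ w ∉ X for all v ∈ V and w ∈ W, where X is any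
-- one of A, B, C.  For fixed X of size d these (V, W) are the independent pairs of
-- a d-regular bipartite graph.  Scanning V once,
-- a vertex with more than t remaining neighbours is either left out or deletes
-- more than t vertices of W, and the vertices with at most t neighbours
-- together with what is left of W number at most N (1 + t / d).  So once d is a
-- large constant, the pairs weighted by l ^ (|V| + |W|) sum to at most
-- (1 + l) ^ (N (1 + ε)).  The triples without an empty member then fall into
-- three kinds:
--   * some member has bounded size: there are at most 3 ^ N choices of the other
--     two, hence O((5/4 · 3) ^ N) triples;
--   * some member X has larger size, but at most N / 3: with l = 1 and the
--     weight 2 ^ (N/3 - |X|) there are about (2 · 3/2 · 2 ^ (1/3)) ^ N triples;
--   * all members are larger than N / 3: with l = 2 there are about
--     (2 · 3 / 2 ^ (2/3)) ^ N triples.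
-- The last two bases coincide, and 3 · 2 ^ (1/3) < 79/20.

open import Defs
open import Algebra.Bundles using (AbelianGroup; CommutativeRing; Group)
import Algebra.Properties.AbelianGroup as AbelianGroupProperties
open import Data.Nat.Base as ℕ using (ℕ)
open import Data.Product.Base using (Σ-syntax; _×_; _,_; proj₁; proj₂)
open import Data.Sum.Base using (_⊎_; inj₁; inj₂)
open import Relation.Binary.PropositionalEquality

module Counting where

  import Algebra.Properties.Semiring.Sum as SemiringSum
  open import Data.Bool.Base using (true; false; if_then_else_)
  open import Data.Fin.Base using (Fin; zero; suc)
  import Data.Fin.Properties as Fin
  open import Data.Fin.Permutation using (Permutation′; permutation; _⟨$⟩ʳ_)
  open import Data.Fin.Subset
  open import Data.Fin.Subset.Properties
  open import Data.List.Base as List using (List; []; _∷_; _++_; length; filter; cartesianProduct)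
  open import Data.Nat.Base using (zero; suc; _+_; _*_; _^_; _≤_; _<_; z≤n; s≤s; NonZero)
  open import Data.Nat.DivMod using (_/_; _%_; m≡m%n+[m/n]*n; m%n<n)
  open import Data.Nat.Properties
  open import Data.Nat.Tactic.RingSolver using (solve-∀)
  open import Data.Vec.Base using ([]; _∷_; lookup; tabulate; here; there)
  open import Data.Vec.Properties using (lookup∘tabulate; []=⇒lookup; lookup⇒[]=)
  open import Function.Base using (_∘_; id)
  open import Function.Bundles using (Inverse)
  open import Level using (Level)
  open import Relation.Nullary using (¬_; Dec; yes; no; does; contradiction)
  open import Relation.Nullary.Decidable using (_→-dec_; ¬?; _×-dec_)
  open SemiringSum +-*-semiring
    using (sum; ∑-comm; ∑-distrib-+; sum-permute; sum-cong-≗; *-distribˡ-sum; *-distribʳ-sum)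

  private
    variable
      p : Level
      A B : Set p
      P : Set p
      N n : ℕ

  x*[y*z]≡y*[x*z] : ∀ x y z → x * (y * z) ≡ y * (x * z)
  x*[y*z]≡y*[x*z] = solve-∀

  -- Sums over lists and over all subsets.

  ∑ : List A → (A → ℕ) → ℕ
  ∑ []       f = 0
  ∑ (x ∷ xs) f = f x + ∑ xs f

  ∑-mono : ∀ (xs : List A) {f g} → (∀ x → f x ≤ g x) → ∑ xs f ≤ ∑ xs g
  ∑-mono []       f≤g = z≤n
  ∑-mono (x ∷ xs) f≤g = +-mono-≤ (f≤g x) (∑-mono xs f≤g)

  ∑-cong : ∀ (xs : List A) {f g} → (∀ x → f x ≡ g x) → ∑ xs f ≡ ∑ xs g
  ∑-cong []       f≡g = refl
  ∑-cong (x ∷ xs) f≡g = cong₂ _+_ (f≡g x) (∑-cong xs f≡g)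

  ∑-+ : ∀ (xs : List A) f g → ∑ xs (λ x → f x + g x) ≡ ∑ xs f + ∑ xs g
  ∑-+ []       f g = refl
  ∑-+ (x ∷ xs) f g rewrite ∑-+ xs f g = interchange (f x) (g x) (∑ xs f) (∑ xs g)
    where
    interchange : ∀ a b c d → a + b + (c + d) ≡ a + c + (b + d)
    interchange = solve-∀

  ∑-*ˡ : ∀ (xs : List A) c f → ∑ xs (λ x → c * f x) ≡ c * ∑ xs f
  ∑-*ˡ []       c f = sym (*-zeroʳ c)
  ∑-*ˡ (x ∷ xs) c f rewrite ∑-*ˡ xs c f = sym (*-distribˡ-+ c (f x) (∑ xs f))

  ∑-*ʳ : ∀ (xs : List A) c f → ∑ xs (λ x → f x * c) ≡ ∑ xs f * c
  ∑-*ʳ xs c f = trans (∑-cong xs λ x → *-comm (f x) c) (trans (∑-*ˡ xs c f) (*-comm c _))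

  ∑-zero : ∀ (xs : List A) → ∑ xs (λ _ → 0) ≡ 0
  ∑-zero []       = refl
  ∑-zero (x ∷ xs) = ∑-zero xs

  ∑-swap : ∀ (xs : List A) (ys : List B) (f : A → B → ℕ) →
    ∑ xs (λ x → ∑ ys (f x)) ≡ ∑ ys (λ y → ∑ xs (λ x → f x y))
  ∑-swap []       ys f = sym (∑-zero ys)
  ∑-swap (x ∷ xs) ys f =
    trans (cong (∑ ys (f x) +_) (∑-swap xs ys f)) (sym (∑-+ ys (f x) _))

  ∑-++ : ∀ (xs : List A) {ys} f → ∑ (xs ++ ys) f ≡ ∑ xs f + ∑ ys f
  ∑-++ []       f = refl
  ∑-++ (x ∷ xs) f = trans (cong (f x +_) (∑-++ xs f)) (sym (+-assoc (f x) _ _))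

  ∑-map : ∀ (g : A → B) xs f → ∑ (List.map g xs) f ≡ ∑ xs (f ∘ g)
  ∑-map g []       f = refl
  ∑-map g (x ∷ xs) f = cong (f (g x) +_) (∑-map g xs f)

  ∑-cartesianProduct : ∀ (xs : List A) (ys : List B) f →
    ∑ (cartesianProduct xs ys) f ≡ ∑ xs (λ x → ∑ ys (λ y → f (x , y)))
  ∑-cartesianProduct []       ys f = refl
  ∑-cartesianProduct (x ∷ xs) ys f = trans (∑-++ (List.map (x ,_) ys) f)
    (cong₂ _+_ (∑-map (x ,_) ys f) (∑-cartesianProduct xs ys f))

  ∑-subsets-suc : ∀ n f → ∑ (subsets (suc n)) f ≡
    ∑ (subsets n) (f ∘ (inside ∷_)) + ∑ (subsets n) (f ∘ (outside ∷_))
  ∑-subsets-suc n f = trans (∑-++ (List.map (inside ∷_) (subsets n)) f)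
    (cong₂ _+_ (∑-map _ (subsets n) f)
      (trans (∑-++ (List.map (outside ∷_) (subsets n)) f)
        (trans (+-identityʳ _) (∑-map _ (subsets n) f))))

  -- Indicators and generating functions of subsets.

  𝟙 : Dec P → ℕ
  𝟙 P? = if does P? then 1 else 0

  𝟙*≤ : ∀ (P? : Dec P) {a b} → (P → a ≤ b) → 𝟙 P? * a ≤ b
  𝟙*≤ (yes x) {a} a≤b = ≤-trans (≤-reflexive (*-identityˡ a)) (a≤b x)
  𝟙*≤ (no  _) a≤b = z≤n

  𝟙≤ : ∀ (P? : Dec P) {b} → (P → 1 ≤ b) → 𝟙 P? ≤ b
  𝟙≤ (yes x) 1≤b = 1≤b x
  𝟙≤ (no  _) 1≤b = z≤n

  1≤𝟙 : ∀ (P? : Dec P) → P → 1 ≤ 𝟙 P?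
  1≤𝟙 (yes _) x = ≤-refl
  1≤𝟙 (no ¬x) x = contradiction x ¬x

  length-filter≡∑ : {P : A → Set p} (P? : ∀ x → Dec (P x)) (xs : List A) →
    length (filter P? xs) ≡ ∑ xs (𝟙 ∘ P?)
  length-filter≡∑ P? []       = refl
  length-filter≡∑ P? (x ∷ xs) with does (P? x)
  ... | true  = cong suc (length-filter≡∑ P? xs)
  ... | false = length-filter≡∑ P? xs

  -- The binomial theorem: each point contributes `a` when it is in `V` and `b` when it is not.
  ∑-powers : ∀ a b n → ∑ (subsets n) (λ V → a ^ ∣ V ∣ * b ^ ∣ ∁ V ∣) ≡ (a + b) ^ n
  ∑-powers a b zero    = refl
  ∑-powers a b (suc n) = begin
    ∑ (subsets (suc n)) (λ V → a ^ ∣ V ∣ * b ^ ∣ ∁ V ∣)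
      ≡⟨ ∑-subsets-suc n _ ⟩
    ∑ (subsets n) (λ V → a * a ^ ∣ V ∣ * b ^ ∣ ∁ V ∣) + ∑ (subsets n) (λ V → a ^ ∣ V ∣ * (b * b ^ ∣ ∁ V ∣))
      ≡⟨ cong₂ _+_ (∑-cong (subsets n) λ V → *-assoc a _ _)
                   (∑-cong (subsets n) λ V → x*[y*z]≡y*[x*z] (a ^ ∣ V ∣) b _) ⟩
    ∑ (subsets n) (λ V → a * (a ^ ∣ V ∣ * b ^ ∣ ∁ V ∣)) + ∑ (subsets n) (λ V → b * (a ^ ∣ V ∣ * b ^ ∣ ∁ V ∣))
      ≡⟨ cong₂ _+_ (∑-*ˡ (subsets n) a _) (∑-*ˡ (subsets n) b _) ⟩
    a * S + b * S
      ≡⟨ *-distribʳ-+ S a b ⟨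
    (a + b) * S
      ≡⟨ cong ((a + b) *_) (∑-powers a b n) ⟩
    (a + b) ^ suc n ∎
    where
    open ≡-Reasoning
    S = ∑ (subsets n) (λ V → a ^ ∣ V ∣ * b ^ ∣ ∁ V ∣)

  -- A point of `R` contributes 1 or `l`; a point outside `R` is forced out of `W`. This sums `W`
  -- away once `V` is fixed.
  ∑-⊆ : ∀ l (R : Subset n) →
    ∑ (subsets n) (λ W → 𝟙 (W ⊆? R) * l ^ ∣ W ∣) ≡ suc l ^ ∣ R ∣
  ∑-⊆ l [] = refl
  ∑-⊆ {suc n} l (true ∷ R) = begin
    ∑ (subsets (suc n)) (λ W → 𝟙 (W ⊆? true ∷ R) * l ^ ∣ W ∣)
      ≡⟨ ∑-subsets-suc n _ ⟩
    ∑ (subsets n) (λ W → 𝟙 (W ⊆? R) * (l * l ^ ∣ W ∣)) + S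
      ≡⟨ cong (_+ S) (∑-cong (subsets n) λ W → x*[y*z]≡y*[x*z] (𝟙 (W ⊆? R)) l _) ⟩
    ∑ (subsets n) (λ W → l * (𝟙 (W ⊆? R) * l ^ ∣ W ∣)) + S
      ≡⟨ cong (_+ S) (∑-*ˡ (subsets n) l _) ⟩
    l * S + S
      ≡⟨ +-comm (l * S) S ⟩
    suc l * S
      ≡⟨ cong (suc l *_) (∑-⊆ l R) ⟩
    suc l ^ suc ∣ R ∣ ∎
    where
    open ≡-Reasoning
    S = ∑ (subsets n) (λ W → 𝟙 (W ⊆? R) * l ^ ∣ W ∣)
  ∑-⊆ {suc n} l (false ∷ R) = trans (∑-subsets-suc n _)
    (trans (cong (_+ ∑ (subsets n) λ W → 𝟙 (W ⊆? R) * l ^ ∣ W ∣) (∑-zero (subsets n))) (∑-⊆ l R))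

  -- Weighted independent pairs of a bipartite graph.

  -- With `ν v` as the neighbourhood of `v`, this is the largest subset of `Q` with no edge to `V`.
  -- The recursion in index order is the scan used in `container`.
  rest : (Fin n → Subset N) → Subset n → Subset N → Subset N
  rest ν []          Q = Q
  rest ν (true  ∷ V) Q = rest (ν ∘ suc) V (Q ─ ν zero)
  rest ν (false ∷ V) Q = rest (ν ∘ suc) V Q

  x∈p─q⁻ : ∀ (p q : Subset n) {x} → x ∈ p ─ q → x ∈ p × x ∉ q
  x∈p─q⁻ (true ∷ _)  (false ∷ _) here = here , λ ()
  x∈p─q⁻ (false ∷ _) (true ∷ _)  {zero} ()
  x∈p─q⁻ (false ∷ _) (false ∷ _) {zero} ()
  x∈p─q⁻ (_ ∷ p) (_ ∷ q) (there x∈) with x∈p─q⁻ p q x∈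
  ... | x∈p , x∉q = there x∈p , λ { (there x∈q) → x∉q x∈q }

  ∣p∩q∣+∣p─q∣≡∣p∣ : ∀ (p q : Subset n) → ∣ q ∩ p ∣ + ∣ p ─ q ∣ ≡ ∣ p ∣
  ∣p∩q∣+∣p─q∣≡∣p∣ []          []          = refl
  ∣p∩q∣+∣p─q∣≡∣p∣ (true ∷ p)  (true ∷ q)  = cong suc (∣p∩q∣+∣p─q∣≡∣p∣ p q)
  ∣p∩q∣+∣p─q∣≡∣p∣ (true ∷ p)  (false ∷ q) = trans (+-suc _ _) (cong suc (∣p∩q∣+∣p─q∣≡∣p∣ p q))
  ∣p∩q∣+∣p─q∣≡∣p∣ (false ∷ p) (true ∷ q)  = ∣p∩q∣+∣p─q∣≡∣p∣ p q
  ∣p∩q∣+∣p─q∣≡∣p∣ (false ∷ p) (false ∷ q) = ∣p∩q∣+∣p─q∣≡∣p∣ p q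

  ∣p∣+∣∁p∣≡n : ∀ (p : Subset n) → ∣ p ∣ + ∣ ∁ p ∣ ≡ n
  ∣p∣+∣∁p∣≡n []          = refl
  ∣p∣+∣∁p∣≡n (true ∷ p)  = cong suc (∣p∣+∣∁p∣≡n p)
  ∣p∣+∣∁p∣≡n (false ∷ p) = trans (+-suc _ _) (cong suc (∣p∣+∣∁p∣≡n p))

  rest-mono : ∀ (ν : Fin n → Subset N) V {Q Q′} → Q ⊆ Q′ → rest ν V Q ⊆ rest ν V Q′
  rest-mono ν []          Q⊆Q′ = Q⊆Q′
  rest-mono ν (true  ∷ V) {Q} Q⊆Q′ = rest-mono (ν ∘ suc) V λ x∈ →
    let x∈Q , x∉ν = x∈p─q⁻ Q _ x∈ in x∈p∧x∉q⇒x∈p─q (Q⊆Q′ x∈Q) x∉ν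
  rest-mono ν (false ∷ V) Q⊆Q′ = rest-mono (ν ∘ suc) V Q⊆Q′

  rest-⊆ : ∀ (ν : Fin n → Subset N) V {Q} → rest ν V Q ⊆ Q
  rest-⊆ ν []          x∈ = x∈
  rest-⊆ ν (true  ∷ V) {Q} x∈ = p─q⊆p Q _ (rest-⊆ (ν ∘ suc) V x∈)
  rest-⊆ ν (false ∷ V) x∈ = rest-⊆ (ν ∘ suc) V x∈

  rest-avoids : ∀ (ν : Fin n → Subset N) V {Q v w} → v ∈ V → w ∈ rest ν V Q → w ∉ ν v
  rest-avoids ν (true  ∷ V) {Q} here  w∈ = proj₂ (x∈p─q⁻ Q _ (rest-⊆ (ν ∘ suc) V w∈))
  rest-avoids ν (true  ∷ V) (there v∈V) w∈ = rest-avoids (ν ∘ suc) V v∈V w∈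
  rest-avoids ν (false ∷ V) (there v∈V) w∈ = rest-avoids (ν ∘ suc) V v∈V w∈

  ⊆-rest : ∀ (ν : Fin n → Subset N) V {W Q} → W ⊆ Q →
    (∀ {v w} → v ∈ V → w ∈ W → w ∉ ν v) → W ⊆ rest ν V Q
  ⊆-rest ν []          W⊆Q av = W⊆Q
  ⊆-rest ν (true  ∷ V) W⊆Q av =
    ⊆-rest (ν ∘ suc) V (λ w∈ → x∈p∧x∉q⇒x∈p─q (W⊆Q w∈) (av here w∈)) (av ∘ there)
  ⊆-rest ν (false ∷ V) W⊆Q av = ⊆-rest (ν ∘ suc) V W⊆Q (av ∘ there)

  -- Independent pairs `(V , W)` with `W ⊆ Q`, weighted by `l ^ (∣ V ∣ + ∣ W ∣)`: by `∑-⊆`, the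
  -- power of `suc l` is the sum over `W`.
  indep : ℕ → (Fin n → Subset N) → Subset N → ℕ
  indep {n} l ν Q = ∑ (subsets n) λ V → l ^ ∣ V ∣ * suc l ^ ∣ rest ν V Q ∣

  indep-suc : ∀ l (ν : Fin (suc n) → Subset N) Q →
    indep l ν Q ≡ l * indep l (ν ∘ suc) (Q ─ ν zero) + indep l (ν ∘ suc) Q
  indep-suc {n} l ν Q = trans (∑-subsets-suc n _) (cong (_+ indep l (ν ∘ suc) Q)
    (trans (∑-cong (subsets n) λ V → *-assoc l _ _) (∑-*ˡ (subsets n) l _)))

  indep-mono : ∀ l (ν : Fin n → Subset N) {Q Q′} → Q ⊆ Q′ → indep l ν Q ≤ indep l ν Q′
  indep-mono {n} l ν Q⊆Q′ = ∑-mono (subsets n) λ V → *-monoʳ-≤ (l ^ ∣ V ∣)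
    (^-monoʳ-≤ (suc l) (p⊆q⇒∣p∣≤∣q∣ (rest-mono ν V Q⊆Q′)))

  Sparse : ℕ → (Fin n → Subset N) → Subset n → Subset N → Set
  Sparse t ν V R = ∀ {v} → v ∈ V → ∣ ν v ∩ R ∣ ≤ t

  p∩-mono : ∀ (p : Subset n) {q r} → q ⊆ r → ∣ p ∩ q ∣ ≤ ∣ p ∩ r ∣
  p∩-mono p {q} q⊆r = p⊆q⇒∣p∣≤∣q∣ λ x∈ →
    let x∈p , x∈q = x∈p∩q⁻ p q x∈ in x∈p∩q⁺ (x∈p , q⊆r x∈q)

  -- Leaving out or taking a vertex of high degree costs a factor 1 + l / Y, since
  -- taking it pays l and gains 1 / Y by lowering k.  A vertex of low degree is
  -- charged to E instead.
  container : ∀ l Y t .{{_ : NonZero Y}} (ν : Fin n → Subset N) Q E k →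
    (∀ V R → R ⊆ Q → Sparse t ν V R → ∣ V ∣ + ∣ R ∣ ≤ E) →
    ∣ Q ∣ ≤ k * t →
    indep l ν Q * Y ^ n ≤ suc l ^ E * (Y + l) ^ n * Y ^ k
  container {zero} l Y t ν Q E k sparse Q≤kt = begin
    (1 * suc l ^ ∣ Q ∣ + 0) * 1
      ≡⟨ trans (*-identityʳ _) (trans (+-identityʳ _) (*-identityˡ _)) ⟩
    suc l ^ ∣ Q ∣
      -- No vertex is left to scan, so the empty `V` and `Q` itself form a sparse pair.
      ≤⟨ ^-monoʳ-≤ (suc l) (sparse [] Q id λ ()) ⟩
    suc l ^ E
      ≡⟨ *-identityʳ _ ⟨
    suc l ^ E * 1
      ≤⟨ m≤m*n _ (Y ^ k) {{m^n≢0 Y k}} ⟩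
    suc l ^ E * 1 * Y ^ k ∎
    where open ≤-Reasoning
  container {suc n} l Y t ν Q E k sparse Q≤kt with ∣ ν zero ∩ Q ∣ ≤? t
  container {suc n} l Y t ν Q E k sparse Q≤kt | yes low with E in eq
  -- `E` cannot be 0: the present vertex alone, with `R` empty, is already a sparse pair.
  ... | zero = contradiction (sparse (true ∷ ⊥) ⊥ (λ x∈ → contradiction x∈ ∉⊥)
          λ { {_} here → ≤-trans (p∩-mono (ν zero) {⊥} (λ x∈ → contradiction x∈ ∉⊥)) low
            ; (there v∈) → contradiction v∈ ∉⊥ }) λ ()
  ... | suc E′ = begin
    indep l ν Q * (Y * Y ^ n)
      ≡⟨ cong (_* (Y * Y ^ n)) (indep-suc l ν Q) ⟩
    (l * indep l (ν ∘ suc) (Q ─ ν zero) + b) * (Y * Y ^ n)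
      -- Ignoring the deletion bounds both branches by `b`. The resulting factor `suc l` is paid by
      -- lowering `E`, since every sparse pair of later vertices extends by the present one.
      ≤⟨ *-monoˡ-≤ (Y * Y ^ n) (+-monoˡ-≤ b (*-monoʳ-≤ l (indep-mono l (ν ∘ suc) (p─q⊆p Q (ν zero))))) ⟩
    (l * b + b) * (Y * Y ^ n)
      ≡⟨ regroup l b Y (Y ^ n) ⟩
    suc l * Y * (b * Y ^ n)
      ≤⟨ *-mono-≤ (*-monoʳ-≤ (suc l) (m≤m+n Y l)) (container l Y t (ν ∘ suc) Q E′ k sparse′ Q≤kt) ⟩
    suc l * (Y + l) * (suc l ^ E′ * (Y + l) ^ n * Y ^ k)
      ≡⟨ regroup′ (suc l) (Y + l) (suc l ^ E′) ((Y + l) ^ n) (Y ^ k) ⟩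
    suc l * suc l ^ E′ * ((Y + l) * (Y + l) ^ n) * Y ^ k ∎
    where
    open ≤-Reasoning
    b = indep l (ν ∘ suc) Q
    regroup : ∀ l b Y y → (l * b + b) * (Y * y) ≡ suc l * Y * (b * y)
    regroup = solve-∀
    regroup′ : ∀ a z e w k → a * z * (e * w * k) ≡ a * e * (z * w) * k
    regroup′ = solve-∀
    sparse′ : ∀ V R → R ⊆ Q → Sparse t (ν ∘ suc) V R → ∣ V ∣ + ∣ R ∣ ≤ E′
    sparse′ V R R⊆Q sp = ℕ.s≤s⁻¹ (sparse (true ∷ V) R R⊆Q
      λ { here → ≤-trans (p∩-mono (ν zero) R⊆Q) low ; (there v∈) → sp v∈ })
  -- `k = 0` forces `Q` to be empty, and then no degree exceeds `t`.
  container {suc n} l Y t ν Q E zero sparse Q≤0 | no high =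
    contradiction (≤-trans (∣p∩q∣≤∣q∣ (ν zero) Q) (≤-trans Q≤0 z≤n)) high
  container {suc n} l Y t ν Q E (suc k) sparse Q≤kt | no high = begin
    indep l ν Q * (Y * Y ^ n)
      ≡⟨ cong (_* (Y * Y ^ n)) (indep-suc l ν Q) ⟩
    (l * a + b) * (Y * Y ^ n)
      ≡⟨ regroup l a b Y (Y ^ n) ⟩
    l * Y * (a * Y ^ n) + Y * (b * Y ^ n)
      -- Taking the vertex deletes more than `t` vertices of `Q`, so `k` drops. The factor `Y` saved
      -- there makes the two branches add up to `Y + l`.
      ≤⟨ +-mono-≤ (*-monoʳ-≤ (l * Y) (container l Y t (ν ∘ suc) (Q ─ ν zero) E k
                    (λ V R R⊆ → sparse′ V R (p─q⊆p Q (ν zero) ∘ R⊆)) Q─ν≤kt))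
                  (*-monoʳ-≤ Y (container l Y t (ν ∘ suc) Q E (suc k) sparse′ Q≤kt)) ⟩
    l * Y * (suc l ^ E * (Y + l) ^ n * Y ^ k) + Y * (suc l ^ E * (Y + l) ^ n * (Y * Y ^ k))
      ≡⟨ regroup′ l Y (suc l ^ E) ((Y + l) ^ n) (Y ^ k) ⟩
    suc l ^ E * ((Y + l) * (Y + l) ^ n) * (Y * Y ^ k) ∎
    where
    open ≤-Reasoning
    a = indep l (ν ∘ suc) (Q ─ ν zero)
    b = indep l (ν ∘ suc) Q
    regroup : ∀ l a b Y y → (l * a + b) * (Y * y) ≡ l * Y * (a * y) + Y * (b * y)
    regroup = solve-∀
    regroup′ : ∀ l Y e z w → l * Y * (e * z * w) + Y * (e * z * (Y * w)) ≡ e * ((Y + l) * z) * (Y * w)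
    regroup′ = solve-∀
    sparse′ : ∀ V R → R ⊆ Q → Sparse t (ν ∘ suc) V R → ∣ V ∣ + ∣ R ∣ ≤ E
    sparse′ V R R⊆Q sp = sparse (false ∷ V) R R⊆Q λ { (there v∈) → sp v∈ }
    Q─ν≤kt : ∣ Q ─ ν zero ∣ ≤ k * t
    Q─ν≤kt = +-cancelˡ-≤ t _ _ (≤-trans (+-monoˡ-≤ ∣ Q ─ ν zero ∣ (<⇒≤ (≰⇒> high)))
      (≤-trans (≤-reflexive (∣p∩q∣+∣p─q∣≡∣p∣ Q (ν zero))) Q≤kt))

  -- Cardinalities as sums of indicator functions.

  sum-mono : ∀ {n} {f g : Fin n → ℕ} → (∀ i → f i ≤ g i) → sum f ≤ sum g
  sum-mono {zero}  f≤g = z≤n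
  sum-mono {suc n} f≤g = +-mono-≤ (f≤g zero) (sum-mono (f≤g ∘ suc))

  sum-const : ∀ n c → sum {n} (λ _ → c) ≡ n * c
  sum-const zero    c = refl
  sum-const (suc n) c = cong (c +_) (sum-const n c)

  χ : Subset n → Fin n → ℕ
  χ V v = if lookup V v then 1 else 0

  ∣V∣≡sum-χ : ∀ (V : Subset n) → ∣ V ∣ ≡ sum (χ V)
  ∣V∣≡sum-χ []          = refl
  ∣V∣≡sum-χ (true ∷ V)  = cong suc (∣V∣≡sum-χ V)
  ∣V∣≡sum-χ (false ∷ V) = ∣V∣≡sum-χ V

  χ-∩ : ∀ (V W : Subset n) v → χ (V ∩ W) v ≡ χ W v * χ V v
  χ-∩ (true ∷ V)  (true ∷ W)  zero = refl
  χ-∩ (true ∷ V)  (false ∷ W) zero = refl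
  χ-∩ (false ∷ V) (true ∷ W)  zero = refl
  χ-∩ (false ∷ V) (false ∷ W) zero = refl
  χ-∩ (_ ∷ V) (_ ∷ W) (suc v) = χ-∩ V W v

  -- Latin squares and their regular bipartite graphs.

  -- As rows and columns are permutations, joining `v` to `w` when `entry v w ∈ X` gives an
  -- `∣ X ∣`-regular bipartite graph.
  record LatinSquare (N : ℕ) : Set where
    field
      entry     : Fin N → Fin N → Fin N
      row col   : Fin N → Permutation′ N
      row-entry : ∀ v w → row v ⟨$⟩ʳ w ≡ entry v w
      col-entry : ∀ v w → col w ⟨$⟩ʳ v ≡ entry v w

    Free : Subset N → Subset N → Subset N → Set
    Free X V W = ∀ v w → v ∈ V → w ∈ W → entry v w ∉ X

    free? : ∀ X V W → Dec (Free X V W)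
    free? X V W = Fin.all? λ v → Fin.all? λ w →
      (v ∈? V) →-dec ((w ∈? W) →-dec ¬? (entry v w ∈? X))

    nbhd : Subset N → Fin N → Subset N
    nbhd X v = tabulate λ w → lookup X (entry v w)

    ∈nbhd⇒ : ∀ {X v w} → w ∈ nbhd X v → entry v w ∈ X
    ∈nbhd⇒ {X} {v} {w} w∈ = lookup⇒[]= _ X (trans (sym (lookup∘tabulate _ w)) ([]=⇒lookup w∈))

    χ-nbhd : ∀ X v w → χ (nbhd X v) w ≡ χ X (entry v w)
    χ-nbhd X v w = cong (if_then 1 else 0) (lookup∘tabulate _ w)

    row-sum : ∀ X v → sum (λ w → χ (nbhd X v) w) ≡ ∣ X ∣
    row-sum X v = trans
      (sum-cong-≗ λ w → trans (χ-nbhd X v w) (cong (χ X) (sym (row-entry v w))))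
      (trans (sym (sum-permute (χ X) (row v))) (sym (∣V∣≡sum-χ X)))

    col-sum : ∀ X w → sum (λ v → χ (nbhd X v) w) ≡ ∣ X ∣
    col-sum X w = trans
      (sum-cong-≗ λ v → trans (χ-nbhd X v w) (cong (χ X) (sym (col-entry v w))))
      (trans (sym (sum-permute (χ X) (col w))) (sym (∣V∣≡sum-χ X)))

    -- Each v ∈ V has at least ∣ X ∣ - t of its edges outside R, and at most
    -- (N - ∣ R ∣) * ∣ X ∣ edges end there; both sides are moved so that no
    -- subtraction occurs.
    sparse-size : ∀ {t} X V R → Sparse t (nbhd X) V R →
      ∣ X ∣ * (∣ V ∣ + ∣ R ∣) ≤ ∣ V ∣ * t + N * ∣ X ∣
    sparse-size {t} X V R sparse = begin
      d * (∣ V ∣ + ∣ R ∣)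
        ≡⟨ trans (*-distribˡ-+ d ∣ V ∣ ∣ R ∣) (cong₂ _+_ (*-comm d ∣ V ∣) (*-comm d ∣ R ∣)) ⟩
      ∣ V ∣ * d + ∣ R ∣ * d
        ≡⟨ cong₂ _+_ (trans (cong (_* d) (∣V∣≡sum-χ V)) (*-distribʳ-sum d (χ V))) R-edges ⟩
      sum (λ v → χ V v * d) + sum (λ v → ∣ nbhd X v ∩ R ∣)
        ≡⟨ ∑-distrib-+ (λ v → χ V v * d) (λ v → ∣ nbhd X v ∩ R ∣) ⟨
      sum (λ v → χ V v * d + ∣ nbhd X v ∩ R ∣)
        ≤⟨ sum-mono bound ⟩
      sum (λ v → χ V v * t + d)
        ≡⟨ ∑-distrib-+ (λ v → χ V v * t) (λ _ → d) ⟩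
      sum (λ v → χ V v * t) + sum {N} (λ _ → d)
        ≡⟨ cong₂ _+_ (trans (sym (*-distribʳ-sum t (χ V))) (cong (_* t) (sym (∣V∣≡sum-χ V)))) (sum-const N d) ⟩
      ∣ V ∣ * t + N * d ∎
      where
      open ≤-Reasoning
      d = ∣ X ∣
      -- Each `w ∈ R` is the end of `d` edges; exchanging the sums regroups them by their other end
      -- `v`.
      R-edges : ∣ R ∣ * d ≡ sum (λ v → ∣ nbhd X v ∩ R ∣)
      R-edges = begin-equality
        ∣ R ∣ * d
          ≡⟨ cong (_* d) (∣V∣≡sum-χ R) ⟩
        sum (χ R) * d
          ≡⟨ *-distribʳ-sum d (χ R) ⟩
        sum (λ w → χ R w * d)
          ≡⟨ sum-cong-≗ (λ w → trans (cong (χ R w *_) (sym (col-sum X w))) (*-distribˡ-sum (χ R w) (λ v → χ (nbhd X v) w))) ⟩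
        sum (λ w → sum (λ v → χ R w * χ (nbhd X v) w))
          ≡⟨ ∑-comm (λ w v → χ R w * χ (nbhd X v) w) ⟩
        sum (λ v → sum (λ w → χ R w * χ (nbhd X v) w))
          ≡⟨ sum-cong-≗ (λ v → trans (sum-cong-≗ λ w → sym (χ-∩ (nbhd X v) R w)) (sym (∣V∣≡sum-χ (nbhd X v ∩ R)))) ⟩
        sum (λ v → ∣ nbhd X v ∩ R ∣) ∎
      degree : ∀ v → ∣ nbhd X v ∣ ≡ d
      degree v = trans (∣V∣≡sum-χ (nbhd X v)) (row-sum X v)
      -- A vertex outside `V` has at most `d` neighbours in `R`. One inside has at most `t`, and its
      -- own term `χ V v * d` matches the `d` on the right.
      bound : ∀ v → χ V v * d + ∣ nbhd X v ∩ R ∣ ≤ χ V v * t + d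
      bound v with lookup V v in eq
      ... | false = ≤-trans (∣p∩q∣≤∣p∣ (nbhd X v) R) (≤-reflexive (degree v))
      ... | true  = ≤-trans (+-monoʳ-≤ (1 * d) (sparse (lookup⇒[]= v V eq)))
        (≤-reflexive (flip-+ d t))
        where
        flip-+ : ∀ d t → 1 * d + t ≡ 1 * t + d
        flip-+ = solve-∀

    weight : ℕ → Subset N → ℕ
    weight l X = ∑ (subsets N) λ V → ∑ (subsets N) λ W →
      𝟙 (free? X V W) * (l ^ ∣ V ∣ * l ^ ∣ W ∣)

    -- For fixed `V`, every `W` that is free with it lies in what `rest` leaves of `⊤`.
    weight≤indep : ∀ l X → weight l X ≤ indep l (nbhd X) ⊤
    weight≤indep l X = ∑-mono (subsets N) λ V → begin
      ∑ (subsets N) (λ W → 𝟙 (free? X V W) * (l ^ ∣ V ∣ * l ^ ∣ W ∣))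
        ≤⟨ ∑-mono (subsets N) (λ W → 𝟙*≤ (free? X V W) λ free → *-monoʳ-≤ (l ^ ∣ V ∣)
            (≤-trans (≤-reflexive (sym (*-identityˡ _)))
              (*-monoˡ-≤ (l ^ ∣ W ∣) (1≤𝟙 (W ⊆? rest (nbhd X) V ⊤)
                (⊆-rest (nbhd X) V (λ _ → ∈⊤) λ v∈ w∈ w∈ν → free _ _ v∈ w∈ (∈nbhd⇒ w∈ν)))))) ⟩
      ∑ (subsets N) (λ W → l ^ ∣ V ∣ * (𝟙 (W ⊆? rest (nbhd X) V ⊤) * l ^ ∣ W ∣))
        ≡⟨ ∑-*ˡ (subsets N) (l ^ ∣ V ∣) _ ⟩
      l ^ ∣ V ∣ * ∑ (subsets N) (λ W → 𝟙 (W ⊆? rest (nbhd X) V ⊤) * l ^ ∣ W ∣)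
        ≡⟨ cong (l ^ ∣ V ∣ *_) (∑-⊆ l (rest (nbhd X) V ⊤)) ⟩
      l ^ ∣ V ∣ * suc l ^ ∣ rest (nbhd X) V ⊤ ∣ ∎
      where open ≤-Reasoning

    -- What `V` leaves meets no neighbourhood of `V`, so `sparse-size` with `t = 0`, divided by
    -- `∣ X ∣`, allows it at most `N - ∣ V ∣` points. Summing `2 ^ (N - ∣ V ∣)` over `V` gives
    -- `3 ^ N`.
    weight-nonempty : ∀ X → 1 ≤ ∣ X ∣ → weight 1 X ≤ 3 ^ N
    weight-nonempty X 1≤d = begin
      weight 1 X
        ≤⟨ weight≤indep 1 X ⟩
      indep 1 (nbhd X) ⊤
        ≤⟨ ∑-mono (subsets N) (λ V → *-monoʳ-≤ (1 ^ ∣ V ∣) (^-monoʳ-≤ 2 (rest≤∁ V))) ⟩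
      ∑ (subsets N) (λ V → 1 ^ ∣ V ∣ * 2 ^ ∣ ∁ V ∣)
        ≡⟨ ∑-powers 1 2 N ⟩
      3 ^ N ∎
      where
      open ≤-Reasoning
      instance _ = ℕ.>-nonZero 1≤d
      rest≤∁ : ∀ V → ∣ rest (nbhd X) V ⊤ ∣ ≤ ∣ ∁ V ∣
      rest≤∁ V = +-cancelˡ-≤ ∣ V ∣ _ _ (≤-trans
        (*-cancelˡ-≤ ∣ X ∣ (≤-trans
          (sparse-size {0} X V R λ {v} v∈ → ≤-reflexive
            (trans (cong ∣_∣ (Empty-unique λ (x , x∈) →
                let x∈ν , x∈R = x∈p∩q⁻ _ R x∈ in rest-avoids (nbhd X) V v∈ x∈R x∈ν))
              (∣⊥∣≡0 N)))
          (≤-reflexive (trans (cong (_+ N * ∣ X ∣) (*-zeroʳ ∣ V ∣)) (*-comm N ∣ X ∣)))))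
        (≤-reflexive (sym (∣p∣+∣∁p∣≡n V))))
        where R = rest (nbhd X) V ⊤

    module _ (m : ℕ) .{{_ : NonZero m}} where
      private
        k = N / m

      N<[1+k]m : N < suc k * m
      N<[1+k]m = ≤-trans (≤-reflexive (cong suc (m≡m%n+[m/n]*n N m))) (+-monoˡ-≤ (k * m) (m%n<n N m))

      -- This is `container` with `t = m`. By `sparse-size` a sparse pair has at most
      -- `N + N * m / d` points, hence at most `N + N / m` because `d` is at least `m * m`.
      weight-large : ∀ l Y .{{_ : NonZero Y}} X → m * m ≤ ∣ X ∣ →
        weight l X * Y ^ N ≤ suc l ^ (N + k) * (Y + l) ^ N * Y ^ suc k
      weight-large l Y X m²≤d = ≤-trans (*-monoˡ-≤ (Y ^ N) (weight≤indep l X))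
        -- `suc k` deletions of `m` vertices exhaust the group even when `m` does not divide `N`.
        (container l Y m (nbhd X) ⊤ (N + k) (suc k) sparse⇒small
          (≤-trans (≤-reflexive (∣⊤∣≡n N)) (<⇒≤ N<[1+k]m)))
        where
        d = ∣ X ∣
        instance
          d≢0 : NonZero d
          d≢0 = ℕ.>-nonZero (≤-trans (*-mono-≤ (ℕ.>-nonZero⁻¹ m) (ℕ.>-nonZero⁻¹ m)) m²≤d)
        sparse⇒small : ∀ V R → R ⊆ ⊤ → Sparse m (nbhd X) V R → ∣ V ∣ + ∣ R ∣ ≤ N + k
        -- A strict bound of `m * s` by `m * suc (N + k)` accounts for the rounding in `k = N / m`.
        sparse⇒small V R _ sparse = ℕ.s≤s⁻¹ (*-cancelˡ-< m _ _ (begin-strict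
          m * s
            ≤⟨ *-cancelˡ-≤ d (begin
                d * (m * s)      ≡⟨ x*[y*z]≡y*[x*z] d m s ⟩
                m * (d * s)      ≤⟨ *-monoʳ-≤ m (sparse-size X V R sparse) ⟩
                m * (∣ V ∣ * m + N * d) ≤⟨ *-monoʳ-≤ m (+-monoˡ-≤ (N * d) (*-monoˡ-≤ m (∣p∣≤n V))) ⟩
                m * (N * m + N * d) ≡⟨ regroup m N d ⟩
                N * (m * m) + d * (m * N)  ≤⟨ +-monoˡ-≤ (d * (m * N)) (*-monoʳ-≤ N m²≤d) ⟩
                N * d + d * (m * N) ≡⟨ regroup′ m N d ⟩
                d * (m * N + N)    ∎) ⟩
          m * N + N
            <⟨ +-monoʳ-< (m * N) N<[1+k]m ⟩
          m * N + suc k * m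
            ≡⟨ regroup″ m N k ⟩
          m * suc (N + k) ∎))
          where
          open ≤-Reasoning
          s = ∣ V ∣ + ∣ R ∣
          regroup : ∀ m N d → m * (N * m + N * d) ≡ N * (m * m) + d * (m * N)
          regroup = solve-∀
          regroup′ : ∀ m N d → N * d + d * (m * N) ≡ d * (m * N + N)
          regroup′ = solve-∀
          regroup″ : ∀ m N n → m * N + suc n * m ≡ m * suc (N + n)
          regroup″ = solve-∀

  -- Comparing powers with exponents `N` and `N / m`.

  *-^ : ∀ a b n → (a * b) ^ n ≡ a ^ n * b ^ n
  *-^ a b zero    = refl
  *-^ a b (suc n) = trans (cong (a * b *_) (*-^ a b n)) (regroup a b (a ^ n) (b ^ n))
    where
    regroup : ∀ a b x y → a * b * (x * y) ≡ a * x * (b * y)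
    regroup = solve-∀

  -- The factor a ^ m absorbs the remainder of N modulo m.
  growth : ∀ N m .{{_ : NonZero m}} a b c e .{{_ : NonZero a}} .{{_ : NonZero c}} →
    a ^ m * b ≤ c ^ m * e → a ^ N * b ^ (N / m) ≤ a ^ m * (c ^ N * e ^ (N / m))
  growth N m a b c e h = begin
    a ^ N * b ^ k
      ≡⟨ cong (_* b ^ k) (split a) ⟩
    a ^ r * (a ^ m) ^ k * b ^ k
      ≡⟨ *-assoc (a ^ r) _ _ ⟩
    a ^ r * ((a ^ m) ^ k * b ^ k)
      ≡⟨ cong (a ^ r *_) (*-^ (a ^ m) b k) ⟨
    a ^ r * (a ^ m * b) ^ k
      ≤⟨ *-mono-≤ (^-monoʳ-≤ a (<⇒≤ (m%n<n N m))) (^-monoˡ-≤ k h) ⟩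
    a ^ m * (c ^ m * e) ^ k
      ≡⟨ cong (a ^ m *_) (*-^ (c ^ m) e k) ⟩
    a ^ m * ((c ^ m) ^ k * e ^ k)
      ≤⟨ *-monoʳ-≤ (a ^ m) (*-monoˡ-≤ (e ^ k) (m≤n*m ((c ^ m) ^ k) (c ^ r) {{m^n≢0 c r}})) ⟩
    a ^ m * (c ^ r * (c ^ m) ^ k * e ^ k)
      ≡⟨ cong (λ x → a ^ m * (x * e ^ k)) (split c) ⟨
    a ^ m * (c ^ N * e ^ k) ∎
    where
    open ≤-Reasoning
    k = N / m
    r = N % m
    split : ∀ x → x ^ N ≡ x ^ r * (x ^ m) ^ k
    split x = begin-equality
      x ^ N               ≡⟨ cong (x ^_) (m≡m%n+[m/n]*n N m) ⟩
      x ^ (r + k * m)     ≡⟨ ^-distribˡ-+-* x r (k * m) ⟩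
      x ^ r * x ^ (k * m) ≡⟨ cong (λ i → x ^ r * x ^ i) (*-comm k m) ⟩
      x ^ r * x ^ (m * k) ≡⟨ cong (x ^ r *_) (^-*-assoc x m k) ⟨
      x ^ r * (x ^ m) ^ k ∎

  -- Sums over triples of subsets.

  ∑³ : ∀ N → (Subset N → Subset N → Subset N → ℕ) → ℕ
  ∑³ N f = ∑ (subsets N) λ A → ∑ (subsets N) λ B → ∑ (subsets N) λ C → f A B C

  ∑³-mono : ∀ N {f g} → (∀ A B C → f A B C ≤ g A B C) → ∑³ N f ≤ ∑³ N g
  ∑³-mono N f≤g = ∑-mono (subsets N) λ A → ∑-mono (subsets N) λ B → ∑-mono (subsets N) (f≤g A B)

  ∑³-+ : ∀ N f g → ∑³ N (λ A B C → f A B C + g A B C) ≡ ∑³ N f + ∑³ N g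
  ∑³-+ N f g = trans
    (∑-cong S λ A → trans (∑-cong S λ B → ∑-+ S (f A B) (g A B)) (∑-+ S _ _))
    (∑-+ S _ _)
    where S = subsets N

  ∑³-*ʳ : ∀ N c f → ∑³ N (λ A B C → f A B C * c) ≡ ∑³ N f * c
  ∑³-*ʳ N c f = trans
    (∑-cong S λ A → trans (∑-cong S λ B → ∑-*ʳ S c (f A B)) (∑-*ʳ S c _))
    (∑-*ʳ S c _)
    where S = subsets N

  ∑³-swap₁ : ∀ N f → ∑³ N (λ A B C → f B A C) ≡ ∑³ N f
  ∑³-swap₁ N f = ∑-swap (subsets N) (subsets N) _

  ∑³-swap₂ : ∀ N f → ∑³ N (λ A B C → f A C B) ≡ ∑³ N f
  ∑³-swap₂ N f = ∑-cong (subsets N) λ A → ∑-swap (subsets N) (subsets N) _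

  ∑³-rotate : ∀ N f → ∑³ N (λ A B C → f C A B) ≡ ∑³ N f
  ∑³-rotate N f = trans (∑³-swap₂ N λ A B C → f B A C) (∑³-swap₁ N f)

  ∑-1 : ∀ N → ∑ (subsets N) (λ _ → 1) ≡ 2 ^ N
  ∑-1 N = trans (∑-cong (subsets N) λ V → sym (cong₂ _*_ (^-zeroˡ ∣ V ∣) (^-zeroˡ ∣ ∁ V ∣))) (∑-powers 1 1 N)

  ∑-const : ∀ N c → ∑ (subsets N) (λ _ → c) ≡ c * 2 ^ N
  ∑-const N c = trans (∑-cong (subsets N) λ _ → sym (*-identityʳ c))
    (trans (∑-*ˡ (subsets N) c _) (cong (c *_) (∑-1 N)))

  ∅ : Subset N → ℕ
  ∅ A = 𝟙 (∣ A ∣ ≟ 0)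

  ∑-∅ : ∀ N → ∑ (subsets N) ∅ ≡ 1
  ∑-∅ zero    = refl
  ∑-∅ (suc N) = trans (∑-subsets-suc N ∅) (cong₂ _+_ (∑-zero (subsets N)) (∑-∅ N))

  ∑-∅* : ∀ N c → ∑ (subsets N) (λ A → ∅ A * c) ≡ c
  ∑-∅* N c = trans (∑-*ʳ (subsets N) c ∅) (trans (cong (_* c) (∑-∅ N)) (*-identityˡ c))

  -- There is one choice of `A`, and `2 ^ N` choices for each of `B` and `C`.
  ∑³-∅ : ∀ N → ∑³ N (λ A B C → ∅ A) ≡ 4 ^ N
  ∑³-∅ N = begin
    ∑³ N (λ A B C → ∅ A)
      ≡⟨ ∑-cong S (λ A → trans (∑-cong S λ B → ∑-const N (∅ A)) (∑-const N (∅ A * 2 ^ N))) ⟩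
    ∑ S (λ A → ∅ A * 2 ^ N * 2 ^ N)
      ≡⟨ ∑-cong S (λ A → trans (*-assoc (∅ A) _ _) (cong (∅ A *_) (sym (*-^ 2 2 N)))) ⟩
    ∑ S (λ A → ∅ A * 4 ^ N)
      ≡⟨ ∑-∅* N (4 ^ N) ⟩
    4 ^ N ∎
    where
    open ≡-Reasoning
    S = subsets N

  ∑³-∅∅ : ∀ N → ∑³ N (λ A B C → ∅ A * ∅ B) ≡ 2 ^ N
  ∑³-∅∅ N = begin
    ∑³ N (λ A B C → ∅ A * ∅ B)
      ≡⟨ ∑-cong S (λ A → ∑-cong S λ B → trans (∑-const N (∅ A * ∅ B)) (*-assoc (∅ A) (∅ B) _)) ⟩
    ∑ S (λ A → ∑ S λ B → ∅ A * (∅ B * 2 ^ N))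
      ≡⟨ ∑-cong S (λ A → trans (∑-*ˡ S (∅ A) _) (cong (∅ A *_) (∑-∅* N (2 ^ N)))) ⟩
    ∑ S (λ A → ∅ A * 2 ^ N)
      ≡⟨ ∑-∅* N (2 ^ N) ⟩
    2 ^ N ∎
    where
    open ≡-Reasoning
    S = subsets N


  -- Counting free triples by the sizes of their members.

  module Count (L : LatinSquare N) where
    open LatinSquare L

    count : {P : Subset N → Subset N → Subset N → Set} → (∀ X V W → Dec (P X V W)) → ℕ
    count P? = ∑³ N λ X V W → 𝟙 (P? X V W) * 𝟙 (free? X V W)

    -- Markov's inequality: each counted triple contributes at least `c` to the weighted sum. For
    -- large triples `l = 2` makes `c` exponentially large.
    count≤weight : ∀ l c {P : Subset N → Subset N → Subset N → Set} (P? : ∀ X V W → Dec (P X V W))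
      {Q : ℕ → Set} (Q? : ∀ d → Dec (Q d)) →
      (∀ X V W → P X V W → Q ∣ X ∣ × c ≤ l ^ ∣ V ∣ * l ^ ∣ W ∣) →
      count P? * c ≤ ∑ (subsets N) λ X → 𝟙 (Q? ∣ X ∣) * weight l X
    count≤weight l c P? Q? P⇒ = begin
      count P? * c
        ≡⟨ ∑³-*ʳ N c (λ X V W → 𝟙 (P? X V W) * 𝟙 (free? X V W)) ⟨
      ∑³ N (λ X V W → 𝟙 (P? X V W) * 𝟙 (free? X V W) * c)
        ≤⟨ ∑³-mono N pointwise ⟩
      ∑³ N (λ X V W → 𝟙 (Q? ∣ X ∣) * (𝟙 (free? X V W) * (l ^ ∣ V ∣ * l ^ ∣ W ∣)))
        ≡⟨ ∑-cong S (λ X → trans (∑-cong S λ V → ∑-*ˡ S (𝟙 (Q? ∣ X ∣)) _) (∑-*ˡ S (𝟙 (Q? ∣ X ∣)) _)) ⟩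
      ∑ S (λ X → 𝟙 (Q? ∣ X ∣) * weight l X) ∎
      where
      open ≤-Reasoning
      S = subsets N
      pointwise : ∀ X V W → 𝟙 (P? X V W) * 𝟙 (free? X V W) * c ≤
        𝟙 (Q? ∣ X ∣) * (𝟙 (free? X V W) * (l ^ ∣ V ∣ * l ^ ∣ W ∣))
      pointwise X V W = ≤-trans (≤-reflexive (*-assoc (𝟙 (P? X V W)) _ _))
        (𝟙*≤ (P? X V W) λ p → let Q-X , c≤ = P⇒ X V W p in
          ≤-trans (*-monoʳ-≤ (𝟙 (free? X V W)) c≤)
            (≤-trans (≤-reflexive (sym (*-identityˡ _)))
              (*-monoˡ-≤ _ (1≤𝟙 (Q? ∣ X ∣) Q-X))))

    -- Here `c` clears the denominator of a bound on `weight l X`, and the binomial theorem sums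
    -- `a ^ ∣ ∁ X ∣` over all `X`.
    ∑-weight≤ : ∀ l c φ a {Q : ℕ → Set} (Q? : ∀ d → Dec (Q d)) →
      (∀ X → Q ∣ X ∣ → weight l X * c ≤ φ * a ^ ∣ ∁ X ∣) →
      ∑ (subsets N) (λ X → 𝟙 (Q? ∣ X ∣) * weight l X) * c ≤ φ * suc a ^ N
    ∑-weight≤ l c φ a Q? bound = begin
      ∑ S (λ X → 𝟙 (Q? ∣ X ∣) * weight l X) * c
        ≡⟨ ∑-*ʳ S c _ ⟨
      ∑ S (λ X → 𝟙 (Q? ∣ X ∣) * weight l X * c)
        ≤⟨ ∑-mono S (λ X → ≤-trans (≤-reflexive (*-assoc (𝟙 (Q? ∣ X ∣)) _ c))
             (𝟙*≤ (Q? ∣ X ∣) (λ q → ≤-trans (bound X q)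
               (*-monoʳ-≤ φ (≤-reflexive (sym (1^*≡ ∣ X ∣ _))))))) ⟩
      ∑ S (λ X → φ * (1 ^ ∣ X ∣ * a ^ ∣ ∁ X ∣))
        ≡⟨ trans (∑-*ˡ S φ _) (cong (φ *_) (∑-powers 1 a N)) ⟩
      φ * suc a ^ N ∎
      where
      open ≤-Reasoning
      S = subsets N
      1^*≡ : ∀ k x → 1 ^ k * x ≡ x
      1^*≡ k x = trans (cong (_* x) (^-zeroˡ k)) (*-identityˡ x)

    -- The factor `a ^ (k - ∣ X ∣)`, at least 1 on sets with at most `k` points, written without
    -- subtraction. It turns a sum over such sets into a binomial sum over all sets.
    a^N≤ : ∀ a .{{_ : NonZero a}} {k} (X : Subset N) → ∣ X ∣ ≤ k → a ^ N ≤ a ^ k * a ^ ∣ ∁ X ∣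
    a^N≤ a {k} X X≤k = begin
      a ^ N                   ≡⟨ cong (a ^_) (∣p∣+∣∁p∣≡n X) ⟨
      a ^ (∣ X ∣ + ∣ ∁ X ∣)   ≡⟨ ^-distribˡ-+-* a ∣ X ∣ _ ⟩
      a ^ ∣ X ∣ * a ^ ∣ ∁ X ∣ ≤⟨ *-monoˡ-≤ _ (^-monoʳ-≤ a X≤k) ⟩
      a ^ k * a ^ ∣ ∁ X ∣     ∎
      where open ≤-Reasoning

    1≤1^*1^ : ∀ i j → 1 ≤ 1 ^ i * 1 ^ j
    1≤1^*1^ i j = ≤-reflexive (sym (cong₂ _*_ (^-zeroˡ i) (^-zeroˡ j)))

  -- The rate is p / q; m is both the degree threshold t and the ratio d / t, and
  -- h / m is the proportion of the group that separates small from large.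
  module Estimates (p q Y m h : ℕ)
    .{{_ : NonZero p}} .{{_ : NonZero q}} .{{_ : NonZero Y}} .{{_ : NonZero m}}
    (tiny-numeric  : 15 * q ≤ 4 * p)
    (small-numeric : (6 * (q * (Y + 1))) ^ m * (2 * (2 ^ h * Y)) ≤ (p * (2 * Y)) ^ m * 1)
    (large-numeric : (6 * (q * (Y + 2))) ^ m * (3 * Y) ≤ (p * Y) ^ m * (2 ^ h * 2 ^ h))
    where

    -- `Kₜ` is the factor `a ^ k` of `a^N≤` for `a = 4`. `Kₛ` and `Kₗ` combine the factor `a ^ m` of
    -- `growth` with the extra `Y` in `Y ^ suc k`.
    Kₜ Kₛ Kₗ : ℕ
    Kₜ = 4 ^ (m * m)
    Kₛ = (6 * (q * (Y + 1))) ^ m * Y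
    Kₗ = (6 * (q * (Y + 2))) ^ m * Y

    private
      6q[Y+]≢0 : ∀ l → NonZero (6 * (q * (Y + suc l)))
      6q[Y+]≢0 l = m*n≢0 6 (q * (Y + suc l))
        where
        instance
          Y+≢0 = ℕ.>-nonZero (≤-trans (s≤s z≤n) (m≤n+m (suc l) Y))
          qY+≢0 = m*n≢0 q (Y + suc l)

      instance
        _ = 6q[Y+]≢0 0
        _ = 6q[Y+]≢0 1
        _ = m*n≢0 2 Y
        _ = m*n≢0 p Y
        _ = m*n≢0 p (2 * Y)

    module _ {N : ℕ} (L : LatinSquare N) where
      private
        k = N / m
      open LatinSquare L
      open Count L

      -- `h * k` is the proportion `h / m` of `N`, up to rounding.
      IsTiny IsSmall : ℕ → Set
      IsTiny  d = 1 ≤ d × d ≤ m * m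
      IsSmall d = m * m ≤ d × d ≤ h * k

      isTiny? : ∀ d → Dec (IsTiny d)
      isTiny? d = (1 ≤? d) ×-dec (d ≤? m * m)

      isSmall? : ∀ d → Dec (IsSmall d)
      isSmall? d = (m * m ≤? d) ×-dec (d ≤? h * k)

      IsLarge : Subset N → Subset N → Subset N → Set
      IsLarge X V W = m * m ≤ ∣ X ∣ × h * k ≤ ∣ V ∣ × h * k ≤ ∣ W ∣

      isLarge? : ∀ X V W → Dec (IsLarge X V W)
      isLarge? X V W = (m * m ≤? ∣ X ∣) ×-dec ((h * k ≤? ∣ V ∣) ×-dec (h * k ≤? ∣ W ∣))

      tiny small large : ℕ
      tiny  = count λ X V W → isTiny? ∣ X ∣
      small = count λ X V W → isSmall? ∣ X ∣
      large = count isLarge?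

      -- Each `X` has at most `3 ^ N` pairs, and the factor `4 ^ (m * m - ∣ X ∣)` makes the sum over
      -- `X` at most `Kₜ * (5/4) ^ N`; `tiny-numeric` compares 15/4 with `p / q`.
      tiny≤ : tiny * q ^ N ≤ Kₜ * p ^ N
      tiny≤ = *-cancelʳ-≤ _ _ (4 ^ N) {{m^n≢0 4 N}} (begin
        tiny * q ^ N * 4 ^ N
          ≡⟨ regroup tiny (q ^ N) (4 ^ N) ⟩
        tiny * 1 * 4 ^ N * q ^ N
          ≤⟨ *-monoˡ-≤ (q ^ N) (*-monoˡ-≤ (4 ^ N) (count≤weight 1 1 (λ X V W → isTiny? ∣ X ∣) isTiny?
               λ X V W t → t , 1≤1^*1^ ∣ V ∣ ∣ W ∣)) ⟩
        ∑ (subsets N) (λ X → 𝟙 (isTiny? ∣ X ∣) * weight 1 X) * 4 ^ N * q ^ N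
          ≤⟨ *-monoˡ-≤ (q ^ N) (∑-weight≤ 1 (4 ^ N) (3 ^ N * Kₜ) 4 isTiny? λ X (1≤d , d≤m²) →
               ≤-trans (*-mono-≤ (weight-nonempty X 1≤d) (a^N≤ 4 X d≤m²))
                 (≤-reflexive (sym (*-assoc (3 ^ N) Kₜ _)))) ⟩
        3 ^ N * Kₜ * 5 ^ N * q ^ N
          ≡⟨ regroup′ (3 ^ N) Kₜ (5 ^ N) (q ^ N) ⟩
        Kₜ * (3 ^ N * 5 ^ N * q ^ N)
          ≡⟨ cong (Kₜ *_) (trans (cong (_* q ^ N) (sym (*-^ 3 5 N))) (sym (*-^ 15 q N))) ⟩
        Kₜ * (15 * q) ^ N
          ≤⟨ *-monoʳ-≤ Kₜ (^-monoˡ-≤ N tiny-numeric) ⟩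
        Kₜ * (4 * p) ^ N
          ≡⟨ trans (cong (Kₜ *_) (*-^ 4 p N)) (regroup″ Kₜ (4 ^ N) (p ^ N)) ⟩
        Kₜ * p ^ N * 4 ^ N ∎)
        where
        open ≤-Reasoning
        regroup : ∀ x y z → x * y * z ≡ x * 1 * z * y
        regroup = solve-∀
        regroup′ : ∀ x u y z → x * u * y * z ≡ u * (x * y * z)
        regroup′ = solve-∀
        regroup″ : ∀ x y z → x * (y * z) ≡ x * z * y
        regroup″ = solve-∀

      -- `weight-large` gives about `2 ^ N` pairs for each `X`, and the factor `2 ^ (h * k - ∣ X ∣)`
      -- sums to `2 ^ (h * k) * (3/2) ^ N`. All powers with exponent `k` are collected for `growth`.
      small≤ : small * q ^ N ≤ Kₛ * p ^ N
      small≤ = *-cancelʳ-≤ _ _ (2 ^ N * Y ^ N) {{m*n≢0 _ _ {{m^n≢0 2 N}} {{m^n≢0 Y N}}}} (begin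
        small * q ^ N * (2 ^ N * Y ^ N)
          ≡⟨ regroup small (q ^ N) (2 ^ N * Y ^ N) ⟩
        small * 1 * (2 ^ N * Y ^ N) * q ^ N
          ≤⟨ *-monoˡ-≤ (q ^ N) (*-monoˡ-≤ (2 ^ N * Y ^ N) (count≤weight 1 1 (λ X V W → isSmall? ∣ X ∣) isSmall?
               λ X V W t → t , 1≤1^*1^ ∣ V ∣ ∣ W ∣)) ⟩
        ∑ (subsets N) (λ X → 𝟙 (isSmall? ∣ X ∣) * weight 1 X) * (2 ^ N * Y ^ N) * q ^ N
          ≤⟨ *-monoˡ-≤ (q ^ N) (∑-weight≤ 1 (2 ^ N * Y ^ N) (φ * 2 ^ (h * k)) 2 isSmall? bound) ⟩
        φ * 2 ^ (h * k) * 3 ^ N * q ^ N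
          ≡⟨ expand ⟩
        (6 * (q * (Y + 1))) ^ N * (2 * (2 ^ h * Y)) ^ k * Y
          ≤⟨ *-monoˡ-≤ Y (growth N m _ _ (p * (2 * Y)) 1 small-numeric) ⟩
        (6 * (q * (Y + 1))) ^ m * ((p * (2 * Y)) ^ N * 1 ^ k) * Y
          ≡⟨ contract ⟩
        Kₛ * p ^ N * (2 ^ N * Y ^ N) ∎)
        where
        open ≤-Reasoning
        φ = 2 ^ (N + k) * (Y + 1) ^ N * Y ^ suc k
        bound : ∀ X → IsSmall ∣ X ∣ → weight 1 X * (2 ^ N * Y ^ N) ≤ φ * 2 ^ (h * k) * 2 ^ ∣ ∁ X ∣
        bound X (m²≤d , d≤hk) = begin
          weight 1 X * (2 ^ N * Y ^ N)
            ≡⟨ move (weight 1 X) (2 ^ N) (Y ^ N) ⟩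
          weight 1 X * Y ^ N * 2 ^ N
            ≤⟨ *-mono-≤ (weight-large m 1 Y X m²≤d) (a^N≤ 2 X d≤hk) ⟩
          φ * (2 ^ (h * k) * 2 ^ ∣ ∁ X ∣)
            ≡⟨ *-assoc φ _ _ ⟨
          φ * 2 ^ (h * k) * 2 ^ ∣ ∁ X ∣ ∎
          where
          move : ∀ x y z → x * (y * z) ≡ x * z * y
          move = solve-∀
        regroup : ∀ x y z → x * y * z ≡ x * 1 * z * y
        regroup = solve-∀
        expand : φ * 2 ^ (h * k) * 3 ^ N * q ^ N ≡ (6 * (q * (Y + 1))) ^ N * (2 * (2 ^ h * Y)) ^ k * Y
        expand = begin-equality
          2 ^ (N + k) * (Y + 1) ^ N * (Y * Y ^ k) * 2 ^ (h * k) * 3 ^ N * q ^ N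
            ≡⟨ cong₂ (λ x y → x * (Y + 1) ^ N * (Y * Y ^ k) * y * 3 ^ N * q ^ N)
                 (^-distribˡ-+-* 2 N k) (sym (^-*-assoc 2 h k)) ⟩
          2 ^ N * 2 ^ k * (Y + 1) ^ N * (Y * Y ^ k) * (2 ^ h) ^ k * 3 ^ N * q ^ N
            ≡⟨ shuffle (2 ^ N) (2 ^ k) ((Y + 1) ^ N) Y (Y ^ k) ((2 ^ h) ^ k) (3 ^ N) (q ^ N) ⟩
          2 ^ N * 3 ^ N * (q ^ N * (Y + 1) ^ N) * (2 ^ k * ((2 ^ h) ^ k * Y ^ k)) * Y
            ≡⟨ cong₂ (λ x y → x * y * Y)
                 (trans (*-^ 6 (q * (Y + 1)) N) (cong₂ _*_ (*-^ 2 3 N) (*-^ q (Y + 1) N)))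
                 (trans (*-^ 2 (2 ^ h * Y) k) (cong (2 ^ k *_) (*-^ (2 ^ h) Y k))) ⟨
          (6 * (q * (Y + 1))) ^ N * (2 * (2 ^ h * Y)) ^ k * Y ∎
          where
          shuffle : ∀ a b c y d e f g → a * b * c * (y * d) * e * f * g ≡ a * f * (g * c) * (b * (e * d)) * y
          shuffle = solve-∀
        contract : (6 * (q * (Y + 1))) ^ m * ((p * (2 * Y)) ^ N * 1 ^ k) * Y ≡ Kₛ * p ^ N * (2 ^ N * Y ^ N)
        contract = trans (cong₂ (λ x y → a * (x * y) * Y)
            (trans (*-^ p (2 * Y) N) (cong (p ^ N *_) (*-^ 2 Y N))) (^-zeroˡ k))
          (shuffle a (p ^ N) (2 ^ N * Y ^ N) Y)
          where
          a = (6 * (q * (Y + 1))) ^ m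
          shuffle : ∀ a b c y → a * (b * c * 1) * y ≡ a * y * b * c
          shuffle = solve-∀

      large≤ : large * q ^ N ≤ Kₗ * p ^ N
      large≤ = *-cancelʳ-≤ _ _ (c * Y ^ N) {{m*n≢0 c _ {{c≢0}} {{m^n≢0 Y N}}}} (begin
        large * q ^ N * (c * Y ^ N)
          ≡⟨ regroup large (q ^ N) c (Y ^ N) ⟩
        large * c * Y ^ N * q ^ N
          ≤⟨ *-monoˡ-≤ (q ^ N) (*-monoˡ-≤ (Y ^ N) (count≤weight 2 c isLarge? (m * m ≤?_)
               λ X V W (x , v , w) → x , *-mono-≤ (^-monoʳ-≤ 2 v) (^-monoʳ-≤ 2 w))) ⟩
        ∑ (subsets N) (λ X → 𝟙 (m * m ≤? ∣ X ∣) * weight 2 X) * Y ^ N * q ^ N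
          ≤⟨ *-monoˡ-≤ (q ^ N) (∑-weight≤ 2 (Y ^ N) φ 1 (m * m ≤?_) λ X m²≤d →
               ≤-trans (weight-large m 2 Y X m²≤d)
                 (≤-reflexive (sym (trans (cong (φ *_) (^-zeroˡ ∣ ∁ X ∣)) (*-identityʳ φ))))) ⟩
        φ * 2 ^ N * q ^ N
          ≡⟨ expand ⟩
        (6 * (q * (Y + 2))) ^ N * (3 * Y) ^ k * Y
          ≤⟨ *-monoˡ-≤ Y (growth N m _ _ (p * Y) (2 ^ h * 2 ^ h) large-numeric) ⟩
        (6 * (q * (Y + 2))) ^ m * ((p * Y) ^ N * (2 ^ h * 2 ^ h) ^ k) * Y
          ≡⟨ contract ⟩
        Kₗ * p ^ N * (c * Y ^ N) ∎)
        where
        open ≤-Reasoning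
        c = 2 ^ (h * k) * 2 ^ (h * k)
        c≢0 : NonZero c
        c≢0 = m*n≢0 _ _ {{m^n≢0 2 (h * k)}} {{m^n≢0 2 (h * k)}}
        φ = 3 ^ (N + k) * (Y + 2) ^ N * Y ^ suc k
        regroup : ∀ x y z w → x * y * (z * w) ≡ x * z * w * y
        regroup = solve-∀
        expand : φ * 2 ^ N * q ^ N ≡ (6 * (q * (Y + 2))) ^ N * (3 * Y) ^ k * Y
        expand = begin-equality
          3 ^ (N + k) * (Y + 2) ^ N * (Y * Y ^ k) * 2 ^ N * q ^ N
            ≡⟨ cong (λ x → x * (Y + 2) ^ N * (Y * Y ^ k) * 2 ^ N * q ^ N) (^-distribˡ-+-* 3 N k) ⟩
          3 ^ N * 3 ^ k * (Y + 2) ^ N * (Y * Y ^ k) * 2 ^ N * q ^ N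
            ≡⟨ shuffle (3 ^ N) (3 ^ k) ((Y + 2) ^ N) Y (Y ^ k) (2 ^ N) (q ^ N) ⟩
          2 ^ N * 3 ^ N * (q ^ N * (Y + 2) ^ N) * (3 ^ k * Y ^ k) * Y
            ≡⟨ cong₂ (λ x y → x * y * Y)
                 (trans (*-^ 6 (q * (Y + 2)) N) (cong₂ _*_ (*-^ 2 3 N) (*-^ q (Y + 2) N)))
                 (*-^ 3 Y k) ⟨
          (6 * (q * (Y + 2))) ^ N * (3 * Y) ^ k * Y ∎
          where
          shuffle : ∀ a b c y d e f → a * b * c * (y * d) * e * f ≡ e * a * (f * c) * (b * d) * y
          shuffle = solve-∀
        contract : (6 * (q * (Y + 2))) ^ m * ((p * Y) ^ N * (2 ^ h * 2 ^ h) ^ k) * Y ≡ Kₗ * p ^ N * (c * Y ^ N)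
        contract = trans (cong₂ (λ x y → a * (x * y) * Y) (*-^ p Y N)
            (trans (*-^ (2 ^ h) (2 ^ h) k) (cong₂ _*_ (^-*-assoc 2 h k) (^-*-assoc 2 h k))))
          (shuffle a (p ^ N) (Y ^ N) c Y)
          where
          a = (6 * (q * (Y + 2))) ^ m
          shuffle : ∀ a b d c y → a * (b * d * c) * y ≡ a * y * b * (c * d)
          shuffle = solve-∀

  -- The Latin squares of the group and the lower bound for `T`.

  -- Inclusion-exclusion truncated at pairs: if `i > 0` of the events hold, then `i` is at most 1
  -- plus the number of pairs among them, and `s` supplies the 1.
  𝟙-bonferroni : ∀ {P Q R : Set} (P? : Dec P) (Q? : Dec Q) (R? : Dec R) {s} →
    (P → 1 ≤ s) → (Q → 1 ≤ s) → (R → 1 ≤ s) →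
    𝟙 P? + (𝟙 Q? + 𝟙 R?) ≤ s + (𝟙 P? * 𝟙 Q? + (𝟙 R? * 𝟙 P? + 𝟙 Q? * 𝟙 R?))
  𝟙-bonferroni (no _)  (no _)  (no _)  f g h = z≤n
  𝟙-bonferroni (yes x) (no _)  (no _)  f g h = ≤-trans (f x) (m≤m+n _ 0)
  𝟙-bonferroni (no _)  (yes y) (no _)  f g h = ≤-trans (g y) (m≤m+n _ 0)
  𝟙-bonferroni (no _)  (no _)  (yes z) f g h = ≤-trans (h z) (m≤m+n _ 0)
  𝟙-bonferroni (yes x) (yes _) (no _)  f g h = +-monoˡ-≤ 1 (f x)
  𝟙-bonferroni (yes x) (no _)  (yes _) f g h = +-monoˡ-≤ 1 (f x)
  𝟙-bonferroni (no _)  (yes y) (yes _) f g h = +-monoˡ-≤ 1 (g y)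
  𝟙-bonferroni (yes _) (yes _) (yes _) f g h = m≤n+m 3 _

  module Addition {a ℓ} (G : AbelianGroup a ℓ) {N : ℕ} (enum : HasOrder G N) where
    open AbelianGroup G hiding (inverse)
      renaming (refl to ≈-refl; sym to ≈-sym; trans to ≈-trans)
    open Group group using (_//_)
    open AbelianGroupProperties G using (xyx⁻¹≈y; //-rightDividesˡ; //-rightDividesʳ; ⁻¹-anti-homo-//)
    open Inverse enum using (to; from; inverse)

    from-to : ∀ x → from (to x) ≈ x
    from-to x = proj₂ inverse refl

    to≡ : ∀ {x i} → x ≈ from i → to x ≡ i
    to≡ = proj₁ inverse

    x∙yx⁻¹≈y : ∀ x y → x ∙ (y ∙ x ⁻¹) ≈ y
    x∙yx⁻¹≈y x y = ≈-trans (≈-sym (assoc x y (x ⁻¹))) (xyx⁻¹≈y x y)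

    x//x//y≈y : ∀ x y → x // (x // y) ≈ y
    x//x//y≈y x y = ≈-trans (∙-congˡ (⁻¹-anti-homo-// x y)) (x∙yx⁻¹≈y x y)

    -- Solving `x + y = z` for `x` or, by commutativity, for `y` gives a difference of the other
    -- two, so `subtraction` serves both `A` and `B`. Solving for `z` gives `addition`.
    subtraction addition : LatinSquare N
    subtraction = record
      { entry     = λ v w → to (from w // from v)
      ; row       = λ v → permutation
          (λ w → to (from w // from v)) (λ w → to (from w ∙ from v))
          (λ w → to≡ (≈-trans (∙-congʳ (from-to _)) (//-rightDividesʳ (from v) (from w))))
          (λ w → to≡ (≈-trans (∙-congʳ (from-to _)) (//-rightDividesˡ (from v) (from w))))
      -- For fixed `w` the map taking `v` to `w - v` is its own inverse.
      ; col       = λ w → let reflect = λ v → to (from w // from v)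
                              involutive = λ v → to≡ (≈-trans (∙-congˡ (⁻¹-cong (from-to _))) (x//x//y≈y (from w) (from v)))
                          in permutation reflect reflect involutive involutive
      ; row-entry = λ v w → refl
      ; col-entry = λ v w → refl
      }
    addition = record
      { entry     = λ v w → to (from v ∙ from w)
      ; row       = λ v → permutation
          (λ w → to (from v ∙ from w)) (λ w → to (from w // from v))
          (λ w → to≡ (≈-trans (∙-congˡ (from-to _)) (x∙yx⁻¹≈y (from v) (from w))))
          (λ w → to≡ (≈-trans (∙-congʳ (from-to _)) (xyx⁻¹≈y (from v) (from w))))
      ; col       = λ w → permutation
          (λ v → to (from v ∙ from w)) (λ v → to (from v // from w))
          (λ v → to≡ (≈-trans (∙-congʳ (from-to _)) (//-rightDividesˡ (from w) (from v))))
          (λ v → to≡ (≈-trans (∙-congʳ (from-to _)) (//-rightDividesʳ (from w) (from v))))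
      ; row-entry = λ v w → refl
      ; col-entry = λ v w → refl
      }

    module _ {A B C : Subset N} (sumFree : SumFree G enum (A , B , C)) where
      private
        member : ∀ {v} {V : Subset N} → v ∈ V → Member G enum (from v) V
        member {v} {V} = subst (_∈ V) (sym (to≡ ≈-refl))

      free-A : LatinSquare.Free subtraction A B C
      free-A v w v∈B w∈C x∈A =
        sumFree (from w // from v) (from v) (from w) x∈A (member v∈B) (member w∈C)
          (//-rightDividesˡ (from v) (from w))

      free-B : LatinSquare.Free subtraction B A C
      free-B v w v∈A w∈C y∈B =
        sumFree (from v) (from w // from v) (from w) (member v∈A) y∈B (member w∈C)
          (x∙yx⁻¹≈y (from v) (from w))

      free-C : LatinSquare.Free addition C A B
      free-C v w v∈A w∈B z∈C =
        sumFree (from v) (from w) (from v ∙ from w) (member v∈A) (member w∈B) z∈C ≈-refl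

    T≡∑³ : T G enum ≡ ∑³ N (λ A B C → 𝟙 (sumFree? G enum (A , B , C)))
    T≡∑³ = trans (length-filter≡∑ (sumFree? G enum) (cartesianProduct S (cartesianProduct S S)))
      (trans (∑-cartesianProduct S (cartesianProduct S S) _)
        (∑-cong S λ A → ∑-cartesianProduct S S _))
      where S = subsets N

    ∣V∣≡0⇒∉ : ∀ {V : Subset N} → ∣ V ∣ ≡ 0 → ∀ {v} → v ∉ V
    ∣V∣≡0⇒∉ V≡0 v∈V = contradiction (≤-trans (x∈p⇒∣p-x∣<∣p∣ v∈V) (≤-reflexive V≡0)) λ ()

    -- A triple with an empty member is sum-free. A given member is empty in `4 ^ N` triples and two
    -- given members in `2 ^ N`, so `𝟙-bonferroni` applies termwise.
    3·4^N≤T+3·2^N : 3 * 4 ^ N ≤ T G enum + 3 * 2 ^ N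
    3·4^N≤T+3·2^N = begin
      3 * 4 ^ N
        ≡⟨ triple (4 ^ N) ⟨
      4 ^ N + (4 ^ N + 4 ^ N)
        ≡⟨ cong₂ _+_ (∑³-∅ N) (cong₂ _+_ (trans (∑³-swap₁ N λ A B C → ∅ A) (∑³-∅ N))
             (trans (∑³-rotate N λ A B C → ∅ A) (∑³-∅ N))) ⟨
      ∑³ N (λ A B C → ∅ A) + (∑³ N (λ A B C → ∅ B) + ∑³ N (λ A B C → ∅ C))
        ≡⟨ trans (∑³-+ N _ _) (cong (∑³ N (λ A B C → ∅ A) +_) (∑³-+ N _ _)) ⟨
      ∑³ N (λ A B C → ∅ A + (∅ B + ∅ C))
        ≤⟨ ∑³-mono N pointwise ⟩
      ∑³ N (λ A B C → 𝟙 (sumFree? G enum (A , B , C)) + (∅ A * ∅ B + (∅ C * ∅ A + ∅ B * ∅ C)))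
        ≡⟨ trans (∑³-+ N _ _) (cong₂ _+_ (sym T≡∑³) (trans (∑³-+ N _ _) (cong₂ _+_ (∑³-∅∅ N)
             (trans (∑³-+ N _ _) (cong₂ _+_ (trans (∑³-rotate N λ A B C → ∅ A * ∅ B) (∑³-∅∅ N))
               (trans (sym (∑³-rotate N λ A B C → ∅ B * ∅ C)) (∑³-∅∅ N))))))) ⟩
      T G enum + (2 ^ N + (2 ^ N + 2 ^ N))
        ≡⟨ cong (T G enum +_) (triple (2 ^ N)) ⟩
      T G enum + 3 * 2 ^ N ∎
      where
      open ≤-Reasoning
      triple : ∀ x → x + (x + x) ≡ 3 * x
      triple = solve-∀
      pointwise : ∀ A B C → ∅ A + (∅ B + ∅ C) ≤
        𝟙 (sumFree? G enum (A , B , C)) + (∅ A * ∅ B + (∅ C * ∅ A + ∅ B * ∅ C))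
      pointwise A B C = 𝟙-bonferroni (∣ A ∣ ≟ 0) (∣ B ∣ ≟ 0) (∣ C ∣ ≟ 0)
        (λ A≡0 → 1≤𝟙 (sumFree? G enum (A , B , C)) λ x y z x∈A → contradiction x∈A (∣V∣≡0⇒∉ A≡0))
        (λ B≡0 → 1≤𝟙 (sumFree? G enum (A , B , C)) λ x y z x∈A y∈B → contradiction y∈B (∣V∣≡0⇒∉ B≡0))
        (λ C≡0 → 1≤𝟙 (sumFree? G enum (A , B , C)) λ x y z x∈A y∈B z∈C → contradiction z∈C (∣V∣≡0⇒∉ C≡0))

  -- The upper bound for `T`.

  module UpperBound (p q Y m h : ℕ)
    .{{_ : NonZero p}} .{{_ : NonZero q}} .{{_ : NonZero Y}} .{{_ : NonZero m}}
    (tiny-numeric  : 15 * q ≤ 4 * p)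
    (small-numeric : (6 * (q * (Y + 1))) ^ m * (2 * (2 ^ h * Y)) ≤ (p * (2 * Y)) ^ m * 1)
    (large-numeric : (6 * (q * (Y + 2))) ^ m * (3 * Y) ≤ (p * Y) ^ m * (2 ^ h * 2 ^ h))
    where
    open Estimates p q Y m h tiny-numeric small-numeric large-numeric

    -- Any of the three members may be the tiny or small one, large triples are counted once, and
    -- the last 3 is for `3 * 2 ^ N`.
    K : ℕ
    K = 3 * (Kₜ + Kₛ) + Kₗ + 3

    module _ {N : ℕ} where
      private
        k = N / m

      -- A majorant, summing to `4 ^ N` plus an error, for the free triples in which `X` is empty,
      -- tiny or small.
      role : LatinSquare N → Subset N → Subset N → Subset N → ℕ
      role L X V W = ∅ X + (𝟙 (isTiny? L ∣ X ∣) * 𝟙 (free? X V W) + 𝟙 (isSmall? L ∣ X ∣) * 𝟙 (free? X V W))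
        where open LatinSquare L

      ∑³-role : ∀ L → ∑³ N (role L) ≡ 4 ^ N + (tiny L + small L)
      ∑³-role L = trans (∑³-+ N _ _) (cong₂ _+_ (∑³-∅ N) (∑³-+ N _ _))

      role-cover : ∀ L {X V W} → LatinSquare.Free L X V W →
        1 ≤ role L X V W ⊎ m * m ≤ ∣ X ∣ × h * k ≤ ∣ X ∣
      role-cover L {X} {V} {W} free with ∣ X ∣ ≟ 0 | ≤-total ∣ X ∣ (m * m) | ≤-total ∣ X ∣ (h * k)
      ... | yes ≡0 | _        | _        = inj₁ (≤-trans (1≤𝟙 (∣ X ∣ ≟ 0) ≡0) (m≤m+n _ _))
      ... | no ≢0  | inj₁ ≤m² | _        = inj₁ (≤-trans (≤-trans
              (*-mono-≤ (1≤𝟙 (isTiny? L ∣ X ∣) (n≢0⇒n>0 ≢0 , ≤m²)) (1≤𝟙 (LatinSquare.free? L X V W) free))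
              (m≤m+n _ _)) (m≤n+m _ (∅ X)))
      ... | no _   | inj₂ ≥m² | inj₁ ≤hk = inj₁ (≤-trans (≤-trans
              (*-mono-≤ (1≤𝟙 (isSmall? L ∣ X ∣) (≥m² , ≤hk)) (1≤𝟙 (LatinSquare.free? L X V W) free))
              (m≤n+m _ _)) (m≤n+m _ (∅ X)))
      ... | no _   | inj₂ ≥m² | inj₂ ≥hk = inj₂ (≥m² , ≥hk)

      module _ {a ℓ} (G : AbelianGroup a ℓ) (enum : HasOrder G N) where
        open Addition G enum

        error : ℕ
        error = (tiny subtraction + small subtraction)
          + (tiny subtraction + small subtraction)
          + (tiny addition + small addition)
          + large subtraction

        -- Each member is tried as `X` in the Latin square that solves for it; if all three attempts
        -- fail, all three members exceed both thresholds.
        cover : ∀ A B C → 𝟙 (sumFree? G enum (A , B , C)) ≤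
          role subtraction A B C + (role subtraction B A C + (role addition C A B
            + 𝟙 (isLarge? subtraction A B C) * 𝟙 (LatinSquare.free? subtraction A B C)))
        cover A B C = 𝟙≤ (sumFree? G enum (A , B , C)) λ sf → covered sf
          (role-cover subtraction (free-A sf)) (role-cover subtraction (free-B sf)) (role-cover addition (free-C sf))
          where
          ρA = role subtraction A B C
          ρB = role subtraction B A C
          ρC = role addition C A B
          λA = 𝟙 (isLarge? subtraction A B C) * 𝟙 (LatinSquare.free? subtraction A B C)
          covered : SumFree G enum (A , B , C) →
            1 ≤ ρA ⊎ m * m ≤ ∣ A ∣ × h * k ≤ ∣ A ∣ → 1 ≤ ρB ⊎ m * m ≤ ∣ B ∣ × h * k ≤ ∣ B ∣ →
            1 ≤ ρC ⊎ m * m ≤ ∣ C ∣ × h * k ≤ ∣ C ∣ → 1 ≤ ρA + (ρB + (ρC + λA))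
          covered sf (inj₁ 1≤) _ _ = ≤-trans 1≤ (m≤m+n ρA _)
          covered sf (inj₂ _) (inj₁ 1≤) _ = ≤-trans (≤-trans 1≤ (m≤m+n ρB _)) (m≤n+m _ ρA)
          covered sf (inj₂ _) (inj₂ _) (inj₁ 1≤) =
            ≤-trans (≤-trans (≤-trans 1≤ (m≤m+n ρC _)) (m≤n+m _ ρB)) (m≤n+m _ ρA)
          -- The remaining case is large: `A` is taken as `X`, so the sizes of `B` and `C` give the
          -- weight.
          covered sf (inj₂ (m²≤A , _)) (inj₂ (_ , hk≤B)) (inj₂ (_ , hk≤C)) =
            ≤-trans (≤-trans (≤-trans
              (*-mono-≤ (1≤𝟙 (isLarge? subtraction A B C) (m²≤A , hk≤B , hk≤C))
                (1≤𝟙 (LatinSquare.free? subtraction A B C) (free-A sf)))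
              (m≤n+m _ ρC)) (m≤n+m _ ρB)) (m≤n+m _ ρA)

        T≤ : T G enum ≤ 3 * 4 ^ N + error
        T≤ = begin
          T G enum
            ≡⟨ T≡∑³ ⟩
          ∑³ N (λ A B C → 𝟙 (sumFree? G enum (A , B , C)))
            ≤⟨ ∑³-mono N cover ⟩
          ∑³ N (λ A B C → role subtraction A B C + (role subtraction B A C + (role addition C A B
            + 𝟙 (isLarge? subtraction A B C) * 𝟙 (LatinSquare.free? subtraction A B C))))
            ≡⟨ trans (∑³-+ N _ _) (cong₂ _+_ (∑³-role subtraction)
                (trans (∑³-+ N _ _) (cong₂ _+_ (trans (∑³-swap₁ N (role subtraction)) (∑³-role subtraction))
                  (trans (∑³-+ N _ _) (cong (_+ large subtraction)
                    (trans (∑³-rotate N (role addition)) (∑³-role addition))))))) ⟩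
          4 ^ N + s + (4 ^ N + s + (4 ^ N + u + large subtraction))
            ≡⟨ regroup (4 ^ N) s u (large subtraction) ⟩
          3 * 4 ^ N + error ∎
          where
          open ≤-Reasoning
          s = tiny subtraction + small subtraction
          u = tiny addition + small addition
          regroup : ∀ x s u l → x + s + (x + s + (x + u + l)) ≡ 3 * x + (s + s + u + l)
          regroup = solve-∀

        error≤ : (error + 3 * 2 ^ N) * q ^ N ≤ K * p ^ N
        error≤ = begin
          (error + 3 * 2 ^ N) * q ^ N
            ≡⟨ expand (tiny subtraction) (small subtraction) (tiny addition) (small addition)
                 (large subtraction) (2 ^ N) (q ^ N) ⟩
          2 * (tiny subtraction * q ^ N) + 2 * (small subtraction * q ^ N)
            + tiny addition * q ^ N + small addition * q ^ N + large subtraction * q ^ N + 3 * (2 ^ N * q ^ N)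
            ≤⟨ +-mono-≤ (+-mono-≤ (+-mono-≤ (+-mono-≤ (+-mono-≤
                 (*-monoʳ-≤ 2 (tiny≤ subtraction)) (*-monoʳ-≤ 2 (small≤ subtraction)))
                 (tiny≤ addition)) (small≤ addition)) (large≤ subtraction))
                 (*-monoʳ-≤ 3 (≤-trans (≤-reflexive (sym (*-^ 2 q N))) (^-monoˡ-≤ N 2q≤p))) ⟩
          2 * (Kₜ * p ^ N) + 2 * (Kₛ * p ^ N) + Kₜ * p ^ N + Kₛ * p ^ N + Kₗ * p ^ N + 3 * p ^ N
            ≡⟨ contract Kₜ Kₛ Kₗ (p ^ N) ⟩
          K * p ^ N ∎
          where
          open ≤-Reasoning
          expand : ∀ t s t′ s′ l x y → ((t + s) + (t + s) + (t′ + s′) + l + 3 * x) * y ≡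
            2 * (t * y) + 2 * (s * y) + t′ * y + s′ * y + l * y + 3 * (x * y)
          expand = solve-∀
          contract : ∀ t s l x → 2 * (t * x) + 2 * (s * x) + t * x + s * x + l * x + 3 * x ≡ (3 * (t + s) + l + 3) * x
          contract = solve-∀
          -- The term `3 * 2 ^ N` fits because `8 * q ≤ 15 * q ≤ 4 * p`.
          2q≤p : 2 * q ≤ p
          2q≤p = *-cancelˡ-≤ 4 (≤-trans (≤-reflexive (sym (*-assoc 4 2 q)))
            (≤-trans (*-monoˡ-≤ q {8} {15} (m≤m+n 8 7)) tiny-numeric))

    K≢0 : NonZero K
    K≢0 = ℕ.>-nonZero (≤-trans (s≤s z≤n) (m≤n+m 3 (3 * (Kₜ + Kₛ) + Kₗ)))

-- From natural numbers to the rational bound.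

open Counting using (module Addition; module UpperBound)
import Algebra.Properties.CommutativeSemiring.Exp as Exp
open import Data.Integer.Base as ℤ using (+_)
import Data.Integer.Properties as ℤ
import Data.Nat.Coprimality as Coprimality
import Data.Nat.Properties as ℕ
open import Data.Rational.Base using (ℚ; 0ℚ; _/_; _-_; _*_; _<_; _≤_; ∣_∣; mkℚ; _+_; -_; *≤*; Positive)
open import Data.Rational.Properties
open import Data.Unit.Base using (tt)

ι : ℕ → ℚ
ι n = + n / 1

-- `+ n / 1` is stuck on a gcd for variable `n`; in this normal form the rational operations
-- compute.
ι≡mkℚ : ∀ n → ι n ≡ mkℚ (+ n) 0 (Coprimality.sym (Coprimality.1-coprimeTo n))
ι≡mkℚ n = normalize-coprime (Coprimality.sym (Coprimality.1-coprimeTo n))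

ι-* : ∀ m n → ι (m ℕ.* n) ≡ ι m * ι n
ι-* m n rewrite ι≡mkℚ m | ι≡mkℚ n = cong (_/ 1) (ℤ.pos-* m n)

ι-+ : ∀ m n → ι (m ℕ.+ n) ≡ ι m + ι n
ι-+ m n rewrite ι≡mkℚ m | ι≡mkℚ n =
  cong (_/ 1) (trans (ℤ.pos-+ m n) (sym (cong₂ ℤ._+_ (ℤ.*-identityʳ (+ m)) (ℤ.*-identityʳ (+ n)))))

ι-mono : ∀ m n → m ℕ.≤ n → ι m ≤ ι n
ι-mono m n m≤n rewrite ι≡mkℚ m | ι≡mkℚ n =
  *≤* (ℤ.*-monoʳ-≤-nonNeg (+ 1) (ℤ.+≤+ m≤n))

ι-^ : ∀ m n → ι (m ℕ.^ n) ≡ ι m ^ℚ n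
ι-^ m ℕ.zero    = refl
ι-^ m (ℕ.suc n) = trans (ι-* m (m ℕ.^ n)) (cong (ι m *_) (ι-^ m n))

ι-pos : ∀ n .{{_ : ℕ.NonZero n}} → Positive (ι n)
ι-pos n = normalize-pos n 1

module _ where
  open AbelianGroupProperties +-0-abelianGroup using (xyx⁻¹≈y; ⁻¹-anti-homo‿-)
  open ≤-Reasoning

  ι-ι≤ : ∀ {a b r} → b ℕ.≤ a → a ℕ.≤ b ℕ.+ r → ∣ ι a - ι b ∣ ≤ ι r
  ι-ι≤ {a} {b} {r} b≤a a≤b+r with d , refl ← ℕ.m≤n⇒∃[o]m+o≡n b≤a = begin
    ∣ ι (b ℕ.+ d) - ι b ∣ ≡⟨ cong (λ x → ∣ x - ι b ∣) (ι-+ b d) ⟩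
    ∣ ι b + ι d - ι b ∣   ≡⟨ cong ∣_∣ (xyx⁻¹≈y (ι b) (ι d)) ⟩
    ∣ ι d ∣               ≡⟨ 0≤p⇒∣p∣≡p (ι-mono 0 d ℕ.z≤n) ⟩
    ι d                   ≤⟨ ι-mono d r (ℕ.+-cancelˡ-≤ b d r a≤b+r) ⟩
    ι r                   ∎

  ∣ι-ι∣≤ : ∀ a b r → a ℕ.≤ b ℕ.+ r → b ℕ.≤ a ℕ.+ r → ∣ ι a - ι b ∣ ≤ ι r
  ∣ι-ι∣≤ a b r a≤b+r b≤a+r with ℕ.≤-total b a
  ... | inj₁ b≤a = ι-ι≤ b≤a a≤b+r
  ... | inj₂ a≤b = begin
    ∣ ι a - ι b ∣     ≡⟨ cong ∣_∣ (⁻¹-anti-homo‿- (ι b) (ι a)) ⟨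
    ∣ - (ι b - ι a) ∣ ≡⟨ ∣-p∣≡∣p∣ (ι b - ι a) ⟩
    ∣ ι b - ι a ∣     ≤⟨ ι-ι≤ a≤b b≤a+r ⟩
    ι r               ∎

-- Here `x` is `p / q`; multiplying by `q ^ n` reduces the claim to an inequality of naturals.
ι≤ι*^ : ∀ r k p q n x .{{_ : ℕ.NonZero q}} → x * ι q ≡ ι p →
  r ℕ.* q ℕ.^ n ℕ.≤ k ℕ.* p ℕ.^ n → ι r ≤ ι k * x ^ℚ n
ι≤ι*^ r k p q n x xq≡p bound =
  *-cancelʳ-≤-pos (ι (q ℕ.^ n)) {{ι-pos (q ℕ.^ n) {{ℕ.m^n≢0 q n}}}} (begin
  ι r * ι (q ℕ.^ n)               ≡⟨ ι-* r (q ℕ.^ n) ⟨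
  ι (r ℕ.* q ℕ.^ n)               ≤⟨ ι-mono (r ℕ.* q ℕ.^ n) (k ℕ.* p ℕ.^ n) bound ⟩
  ι (k ℕ.* p ℕ.^ n)               ≡⟨ trans (ι-* k (p ℕ.^ n)) (cong (ι k *_) (ι-^ p n)) ⟩
  ι k * ι p ^ℚ n                  ≡⟨ cong (λ y → ι k * y ^ℚ n) xq≡p ⟨
  ι k * (x * ι q) ^ℚ n            ≡⟨ cong (ι k *_) (^-distrib-* x (ι q) n) ⟩
  ι k * (x ^ℚ n * ι q ^ℚ n)       ≡⟨ cong (λ y → ι k * (x ^ℚ n * y)) (ι-^ q n) ⟨
  ι k * (x ^ℚ n * ι (q ℕ.^ n))    ≡⟨ *-assoc (ι k) (x ^ℚ n) (ι (q ℕ.^ n)) ⟨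
  ι k * x ^ℚ n * ι (q ℕ.^ n)      ∎)
  where
  open ≤-Reasoning
  open Exp (CommutativeRing.commutativeSemiring +-*-commutativeRing) using (^-distrib-*)

-- Y = 100 and m = 300 make the loss (1 + 2 / Y) (3 Y) ^ (1 / m) smaller than
-- (79/20) / (3 · 2 ^ (1/3)), which exceeds 1.04.
private
  module Bound = UpperBound 79 20 100 300 100
    (ℕ.≤ᵇ⇒≤ (15 ℕ.* 20) (4 ℕ.* 79) tt)
    (ℕ.≤ᵇ⇒≤
      ((6 ℕ.* (20 ℕ.* (100 ℕ.+ 1))) ℕ.^ 300 ℕ.* (2 ℕ.* (2 ℕ.^ 100 ℕ.* 100)))
      ((79 ℕ.* (2 ℕ.* 100)) ℕ.^ 300 ℕ.* 1) tt)
    (ℕ.≤ᵇ⇒≤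
      ((6 ℕ.* (20 ℕ.* (100 ℕ.+ 2))) ℕ.^ 300 ℕ.* (3 ℕ.* 100))
      ((79 ℕ.* 100) ℕ.^ 300 ℕ.* (2 ℕ.^ 100 ℕ.* 2 ℕ.^ 100)) tt)

-- A single error `r` bounds both directions. As `k` is a variable, the rational argument does not
-- compute with the huge numeral `Bound.K`.
fromℕ-bound : ∀ {a ℓ} (k : ℕ) .{{_ : ℕ.NonZero k}} →
  ((G : AbelianGroup a ℓ) (N : ℕ) (enum : HasOrder G N) → Σ[ r ∈ ℕ ]
    T G enum ℕ.≤ 3 ℕ.* 4 ℕ.^ N ℕ.+ r ×
    3 ℕ.* 4 ℕ.^ N ℕ.≤ T G enum ℕ.+ r ×
    r ℕ.* 20 ℕ.^ N ℕ.≤ k ℕ.* 79 ℕ.^ N) →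
  Σ[ c ∈ ℚ ] Σ[ K ∈ ℚ ] 0ℚ < c × 0ℚ < K ×
  ((G : AbelianGroup a ℓ) (N : ℕ) (enum : HasOrder G N) →
  ∣ (+ T G enum) / 1 - (+ (3 ℕ.* 4 ℕ.^ N)) / 1 ∣ ≤ K * (((+ 4) / 1 - c) ^ℚ N))
fromℕ-bound k h =
  -- `c = 1/20` makes `4 - c` equal to 79/20, the rate `p / q` used for the estimates.
  + 1 / 20 , ι k , positive⁻¹ (+ 1 / 20) , positive⁻¹ (ι k) {{ι-pos k}} , λ G N enum →
    let r , T≤ , ≤T , r≤ = h G N enum
    in ≤-trans (∣ι-ι∣≤ (T G enum) (3 ℕ.* 4 ℕ.^ N) r T≤ ≤T) (ι≤ι*^ r k 79 20 N (+ 79 / 20) refl r≤)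

theorem6 : ∀ {a ℓ} →
    Σ[ c ∈ ℚ ] Σ[ K ∈ ℚ ] 0ℚ < c × 0ℚ < K ×
    ((G : AbelianGroup a ℓ) (N : ℕ) (enum : HasOrder G N) →
    ∣ (+ T G enum) / 1 - (+ (3 ℕ.* 4 ℕ.^ N)) / 1 ∣ ≤ K * (((+ 4) / 1 - c) ^ℚ N))
theorem6 = fromℕ-bound Bound.K {{Bound.K≢0}} λ G N enum →
  -- The first summand covers the excess of `T` over `3 * 4 ^ N`, the second its deficit.
  Bound.error G enum ℕ.+ 3 ℕ.* 2 ℕ.^ N ,
  ℕ.≤-trans (Bound.T≤ G enum) (ℕ.+-monoʳ-≤ (3 ℕ.* 4 ℕ.^ N) (ℕ.m≤m+n (Bound.error G enum) (3 ℕ.* 2 ℕ.^ N))) ,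
  ℕ.≤-trans (Addition.3·4^N≤T+3·2^N G enum) (ℕ.+-monoʳ-≤ (T G enum) (ℕ.m≤n+m (3 ℕ.* 2 ℕ.^ N) (Bound.error G enum))) ,
  Bound.error≤ G enum
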